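{- Let $K\subset L$ be an extension of fields (possibly skew), with $K$ commutative and central in $L$. Then $L$ has the linear matching property if and only if $L$ contains no proper finite-dimensional extension over $K$, i.e. there is no (possibly skew) field $M$ with $K\subsetneq M\subsetneq L$ and $\dim_K M<\infty$.
   Context: "Field" means a division ring (skew field); a "commutative field" is a field with commutative multiplication. $K$ is central in $L$ if $\lambda x=x\lambda$ for all $\lambda\in K$, $x\in L$. Intermediate fields $M$ are sub-division-rings of $L$ containing $K$. The extension $L$ of $K$ may be finite- or infinite-dimensional. Let $A,B$ be $n$-dimensional $K$-subspaces of $L$, with (indexed) bases $\mathcal{A}=\{a_1,\ldots,a_n\}$ of $A$ and $\mathcal{B}=\{b_1,\ldots,b_n\}$ of $B$. We say that $\mathcal{A}$ is matched to $\mathcal{B}$ if for all $i=1,\ldots,n$ and all $b\in B$: $a_ib\in A$ implies $b\in\langle b_1,\ldots,\widehat{b_i},\ldots,b_n\rangle$; equivalently, $a_i^{ -1}A\cap B\subset\langle b_1,\ldots,\widehat{b_i},\ldots,b_n\rangle$ for all $i$. Here $\langle b_1,\ldots,\widehat{b_i},\ldots,b_n\rangle$ is the $K$-subspace spanned by the $b_j$ with $j\neq i$. We say that $A$ is matched to $B$ if every basis $\mathcal{A}$ of $A$ can be matched to some basis $\mathcal{B}$ of $B$ (i.e. for every basis $\mathcal{A}$ there exists a basis $\mathcal{B}$ of $B$ such that $\mathcal{A}$ is matched to $\mathcal{B}$). $L$ (as an extension of $K$) has the linear matching property if, for every $n\ge 1$ and all $n$-dimensional $K$-subspaces $A,B$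 of $L$ with $1\notin B$, the subspace $A$ is matched to $B$. -}

module Defs where

open import Algebra.Bundles using (Ring)
import Algebra.Definitions
import Algebra.Properties.Semiring.Sum
open import Data.Nat.Base using (ℕ; suc)
open import Data.Product.Base using (∃-syntax; Σ-syntax; _×_)
open import Data.Vec.Functional using (Vector; removeAt)
open import Level using (Level; _⊔_) renaming (suc to lsuc)
open import Relation.Binary.Definitions using (_Respects_)
open import Relation.Nullary.Negation using (¬_)
open import Relation.Unary using (Pred; _∈_; _∉_)

record DivisionRing (c ℓ : Level) : Set (lsuc (c ⊔ ℓ)) where
  field
    ring : Ring c ℓ
  open Ring ring public
  open Algebra.Definitions _≈_ using (Invertible)
  field
    0≉1     : ¬ (0# ≈ 1#)
    inverse : ∀ x → ¬ (x ≈ 0#) → Invertible 1# _*_ x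

-- Subsets of L are predicates respecting the equality _≈_ of L.
module _ {c ℓ : Level} (L : DivisionRing c ℓ) where
  open DivisionRing L
  open Algebra.Properties.Semiring.Sum semiring using (sum)

  record IsSubDivisionRing {m} (M : Pred Carrier m) : Set (c ⊔ ℓ ⊔ m) where
    field
      resp       : M Respects _≈_
      0-closed   : 0# ∈ M
      1-closed   : 1# ∈ M
      +-closed   : ∀ {x y} → x ∈ M → y ∈ M → x + y ∈ M
      neg-closed : ∀ {x} → x ∈ M → - x ∈ M
      *-closed   : ∀ {x y} → x ∈ M → y ∈ M → x * y ∈ M
      -- 0# has no inverse, and the y below is the inverse of x.
      inv-closed : ∀ {x y} → x ∈ M → x * y ≈ 1# → y ∈ M

  IsCommutativeSubset : ∀ {k} → Pred Carrier k → Set (c ⊔ ℓ ⊔ k)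
  IsCommutativeSubset K = ∀ {x y} → x ∈ K → y ∈ K → x * y ≈ y * x

  IsCentral : ∀ {k} → Pred Carrier k → Set (c ⊔ ℓ ⊔ k)
  IsCentral K = ∀ {x} → x ∈ K → ∀ y → x * y ≈ y * x

  -- Linear algebra over K; scalars act on L by left multiplication.
  module _ {k : Level} (K : Pred Carrier k) where

    record IsSubspace {a} (A : Pred Carrier a) : Set (c ⊔ ℓ ⊔ k ⊔ a) where
      field
        resp     : A Respects _≈_
        0-closed : 0# ∈ A
        +-closed : ∀ {x y} → x ∈ A → y ∈ A → x + y ∈ A
        *-closed : ∀ {s x} → s ∈ K → x ∈ A → s * x ∈ A

    Span : ∀ {n} → Vector Carrier n → Pred Carrier (c ⊔ ℓ ⊔ k)
    Span {n} v x =
      Σ[ s ∈ Vector Carrier n ] (∀ i → s i ∈ K) × x ≈ sum (λ i → s i * v i)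

    LinearlyIndependent : ∀ {n} → Vector Carrier n → Set (c ⊔ ℓ ⊔ k)
    LinearlyIndependent {n} v =
      (s : Vector Carrier n) → (∀ i → s i ∈ K) →
      sum (λ i → s i * v i) ≈ 0# → ∀ i → s i ≈ 0#

    record IsBasis {a n} (A : Pred Carrier a) (v : Vector Carrier n)
                   : Set (c ⊔ ℓ ⊔ k ⊔ a) where
      field
        members     : ∀ i → v i ∈ A
        independent : LinearlyIndependent v
        spanning    : ∀ {x} → x ∈ A → x ∈ Span v

    record HasDimension {a} (A : Pred Carrier a) (n : ℕ)
                        : Set (c ⊔ ℓ ⊔ k ⊔ a) where
      field
        isSubspace : IsSubspace A
        hasBasis   : Σ[ v ∈ Vector Carrier n ] IsBasis A v

    FiniteDimensional : ∀ {a} → Pred Carrier a → Set (c ⊔ ℓ ⊔ k ⊔ a)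
    FiniteDimensional A = ∃[ n ] HasDimension A n

    -- In BasisMatched and Matched the families have suc n ≥ 1 entries, so that
    -- one can be omitted.
    BasisMatched : ∀ {a b n} (A : Pred Carrier a) (B : Pred Carrier b) →
                   Vector Carrier (suc n) → Vector Carrier (suc n) →
                   Set (c ⊔ ℓ ⊔ k ⊔ a ⊔ b)
    BasisMatched A B u v =
      ∀ i x → x ∈ B → u i * x ∈ A → x ∈ Span (removeAt v i)

    Matched : ∀ {a b} (n : ℕ) → Pred Carrier a → Pred Carrier b →
              Set (c ⊔ ℓ ⊔ k ⊔ a ⊔ b)
    Matched n A B =
      (u : Vector Carrier (suc n)) → IsBasis A u →
      Σ[ v ∈ Vector Carrier (suc n) ] IsBasis B v × BasisMatched A B u v

    -- Subsets at level c ⊔ ℓ ⊔ k suffice: every finite-dimensional subspace,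
    -- at whatever level, is extensionally equal to the span of a basis.
    Subset : Set (lsuc (c ⊔ ℓ ⊔ k))
    Subset = Pred Carrier (c ⊔ ℓ ⊔ k)

    -- The common dimension of A and B is suc n, i.e. at least 1.
    LinearMatchingProperty : Set (lsuc (c ⊔ ℓ ⊔ k))
    LinearMatchingProperty =
      ∀ n (A B : Subset) → HasDimension A (suc n) → HasDimension B (suc n) →
      1# ∉ B → Matched n A B

{-# OPTIONS --safe #-}
-- (⇐) Kemperman's transform gives the linear Cauchy–Davenport inequality
-- dim V + dim W ≤ dim A + 1 for nonzero V, W with V W ⊆ A ≠ L: for a unit e, both
-- (V ∩ V e, W + e⁻¹ W) and (V + V e, W ∩ e⁻¹ W) have products in A, and an e making progress
-- exists because v⁻¹ V (or W w⁻¹) would otherwise be an intermediate division ring.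
-- For a basis (uᵢ) of A let Vᵢ = uᵢ⁻¹ A ∩ B.  If X is the intersection of the Vᵢ with i ∈ J,
-- then ⟨uᵢ : i ∈ J⟩ (X + K) ⊆ A, and 1 ∉ B gives dim X + |J| ≤ n.  By the dual form of Rado's
-- theorem the Vᵢ can be enlarged to hyperplanes of B with zero intersection, and these are the
-- coordinate hyperplanes of the required basis.
-- (⇒) Given an intermediate M, choose a hyperplane C of M with 1 ∉ C and z ∉ M.  Then M is not
-- matched to C + K z, because every nonzero α ∈ C satisfies u α ∈ M for all u ∈ M.

module Submission where

open import Defs
open import Axiom.ExcludedMiddle using (ExcludedMiddle)
open import Data.Empty using (⊥; ⊥-elim)
open import Data.Fin.Base using (Fin; zero; suc; punchIn; punchOut)
import Data.Fin.Properties as Fin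
import Data.Fin.Subset as Subset
import Data.Fin.Subset.Properties as Subset
open import Data.List.Base using (List; []; _∷_; allFin)
open import Data.List.Membership.Propositional.Properties using (∈-allFin)
open import Data.List.Relation.Unary.All as All using (All; []; _∷_)
open import Data.Nat.Base as ℕ using (ℕ; zero; suc; z≤n; s≤s)
import Data.Nat.Properties as ℕ
open import Data.Product.Base using (Σ-syntax; ∃; _×_; _,_; proj₁; proj₂)
open import Data.Sum.Base using (_⊎_; inj₁; inj₂; [_,_]′)
open import Data.Unit.Base using (tt)
open import Data.Vec.Base using ([]; _∷_; here; there)
open import Data.Vec.Functional using (Vector; head; tail; removeAt; insertAt; updateAt)
  renaming (_∷_ to _∷ᵛ_; [] to []ᵛ)
open import Data.Vec.Functional.Properties
  using (updateAt-updates; updateAt-minimal; insertAt-lookup; insertAt-punchIn)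
open import Function.Base using (_∘_; id; case_of_)
open import Function.Bundles using (_⇔_; mk⇔)
open import Level using (_⊔_; Lift; lift) renaming (suc to lsuc)
open import Relation.Binary.PropositionalEquality as ≡ using (_≡_)
open import Relation.Nullary.Decidable.Core using (Dec; yes; no; decidable-stable)
open import Relation.Nullary.Negation using (¬_; contradiction)
open import Relation.Unary using (Pred; _⊂_; U; _∈_; _∉_; _⊆_)

-- Inequalities between natural numbers and cardinalities of finite subsets

-- The sums `a + d` and `b + e` have mean `c + f`, so when one falls below it the other exceeds it.
-- Each of the pairs `a`, `b` and `d`, `e` will consist of the dimensions of the intersection and
-- the sum of a space and a translate of it.
balance : ∀ {a b c d e f} → a ℕ.+ b ≡ c ℕ.+ c → d ℕ.+ e ≡ f ℕ.+ f →
          a ℕ.+ d ℕ.< c ℕ.+ f → c ℕ.+ f ℕ.< b ℕ.+ e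
balance {a} {b} {c} {d} {e} {f} eq₁ eq₂ a+d<c+f = ℕ.≰⇒> λ b+e≤c+f → ℕ.<-irrefl total
  (ℕ.+-mono-<-≤ a+d<c+f b+e≤c+f)
  where
  open ≡.≡-Reasoning
  open import Algebra.Properties.CommutativeSemigroup ℕ.+-commutativeSemigroup using (interchange)
  total : (a ℕ.+ d) ℕ.+ (b ℕ.+ e) ≡ (c ℕ.+ f) ℕ.+ (c ℕ.+ f)
  total = begin
    (a ℕ.+ d) ℕ.+ (b ℕ.+ e)  ≡⟨ interchange a d b e ⟩
    (a ℕ.+ b) ℕ.+ (d ℕ.+ e)  ≡⟨ ≡.cong₂ ℕ._+_ eq₁ eq₂ ⟩
    (c ℕ.+ c) ℕ.+ (f ℕ.+ f)  ≡⟨ interchange c c f f ⟩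
    (c ℕ.+ f) ℕ.+ (c ℕ.+ f)  ∎

below-average : ∀ {a b c} → a ℕ.+ b ≡ c ℕ.+ c → c ℕ.< b → a ℕ.< c
below-average eq c<b = ℕ.≰⇒> λ c≤a → ℕ.<-irrefl (≡.sym eq) (ℕ.+-mono-≤-< c≤a c<b)

-- With `d = 0` the equation gives `e = f + f`, which is at least `c + f`. This keeps the
-- intersection factor of a transform nonzero.
balance-positive : ∀ {a c d e f} → d ℕ.+ e ≡ f ℕ.+ f → a ℕ.+ e ℕ.< c ℕ.+ f → c ℕ.≤ f → 1 ℕ.≤ d
balance-positive {d = suc _} _ _ _ = s≤s z≤n
balance-positive {a} {c} {zero} {e} {f} ≡.refl a+e<c+f c≤f =
  contradiction (ℕ.≤-trans (ℕ.+-monoˡ-≤ f c≤f) (ℕ.m≤n+m e a)) (ℕ.<⇒≱ a+e<c+f)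

∣p∩q∣+∣p∪q∣ : ∀ {n} (p q : Subset.Subset n) →
  Subset.∣ p Subset.∩ q ∣ ℕ.+ Subset.∣ p Subset.∪ q ∣ ≡ Subset.∣ p ∣ ℕ.+ Subset.∣ q ∣
∣p∩q∣+∣p∪q∣ [] [] = ≡.refl
∣p∩q∣+∣p∪q∣ (Subset.outside ∷ p) (Subset.outside ∷ q) = ∣p∩q∣+∣p∪q∣ p q
∣p∩q∣+∣p∪q∣ (Subset.outside ∷ p) (Subset.inside ∷ q) =
  ≡.trans (ℕ.+-suc _ _) (≡.trans (≡.cong suc (∣p∩q∣+∣p∪q∣ p q)) (≡.sym (ℕ.+-suc _ _)))
∣p∩q∣+∣p∪q∣ (Subset.inside ∷ p) (Subset.outside ∷ q) =
  ≡.trans (ℕ.+-suc _ _) (≡.cong suc (∣p∩q∣+∣p∪q∣ p q))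
∣p∩q∣+∣p∪q∣ (Subset.inside ∷ p) (Subset.inside ∷ q) = ≡.cong suc
  (≡.trans (ℕ.+-suc _ _) (≡.trans (≡.cong suc (∣p∩q∣+∣p∪q∣ p q)) (≡.sym (ℕ.+-suc _ _))))

∣p∣≤1+∣p-x∣ : ∀ {n} (p : Subset.Subset n) x → Subset.∣ p ∣ ℕ.≤ suc Subset.∣ p Subset.- x ∣
∣p∣≤1+∣p-x∣ p x = begin
  Subset.∣ p ∣                              ≤⟨ Subset.p⊆q⇒∣p∣≤∣q∣ p⊆ ⟩
  Subset.∣ q Subset.∪ Subset.⁅ x ⁆ ∣         ≤⟨ ℕ.m≤n+m _ Subset.∣ q Subset.∩ Subset.⁅ x ⁆ ∣ ⟩
  Subset.∣ q Subset.∩ Subset.⁅ x ⁆ ∣ ℕ.+ Subset.∣ q Subset.∪ Subset.⁅ x ⁆ ∣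
                                            ≡⟨ ∣p∩q∣+∣p∪q∣ q Subset.⁅ x ⁆ ⟩
  Subset.∣ q ∣ ℕ.+ Subset.∣ Subset.⁅ x ⁆ ∣   ≡⟨ ≡.cong (Subset.∣ q ∣ ℕ.+_) (Subset.∣⁅x⁆∣≡1 x) ⟩
  Subset.∣ q ∣ ℕ.+ 1                        ≡⟨ ℕ.+-comm Subset.∣ q ∣ 1 ⟩
  suc Subset.∣ q ∣                          ∎
  where
  open ℕ.≤-Reasoning
  q = p Subset.- x
  p⊆ : p Subset.⊆ q Subset.∪ Subset.⁅ x ⁆
  p⊆ {y} y∈p with y Fin.≟ x
  ... | yes ≡.refl = Subset.x∈p∪q⁺ {p = q} (inj₂ (Subset.x∈⁅x⁆ x))
  ... | no y≢x     = Subset.x∈p∪q⁺ {p = q} (inj₁ (Subset.x∈p∧x≢y⇒x∈p-y y∈p y≢x))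

x∉p-x : ∀ {n} (p : Subset.Subset n) x → ¬ x Subset.∈ p Subset.- x
x∉p-x (_ ∷ p) (suc x) (there x∈) = x∉p-x p x x∈

-- The numerical core of `enlarge-Hall`. Here `d`, `e`, `f`, `g` are the dimensions of two spaces,
-- their intersection and their sum; `a`, `b`, `h`, `i` are the cardinalities of two index sets,
-- their intersection and their union; `j` is `h` after deleting one index. The two violations give
-- a surplus of 2, and the deletion accounts for only 1.
hall-counting : ∀ {n d e a b f g h i j} → n ℕ.< d ℕ.+ a → n ℕ.< e ℕ.+ b → f ℕ.+ g ≡ d ℕ.+ e →
  h ℕ.+ i ≡ a ℕ.+ b → f ℕ.+ i ℕ.≤ n → g ℕ.+ j ℕ.≤ n → h ℕ.≤ suc j → ⊥
hall-counting {n} {d} {e} {a} {b} {f} {g} {h} {i} {j} n<d+a n<e+b f+g≡d+e h+i≡a+b f+i≤n g+j≤n h≤1+j =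
  ℕ.<-irrefl ≡.refl (begin
    suc n ℕ.+ suc n              ≤⟨ ℕ.+-mono-≤ n<d+a n<e+b ⟩
    (d ℕ.+ a) ℕ.+ (e ℕ.+ b)      ≡⟨ interchange d a e b ⟩
    (d ℕ.+ e) ℕ.+ (a ℕ.+ b)      ≡⟨ ≡.cong₂ ℕ._+_ f+g≡d+e h+i≡a+b ⟨
    (f ℕ.+ g) ℕ.+ (h ℕ.+ i)      ≤⟨ ℕ.+-monoʳ-≤ (f ℕ.+ g) h+i≤ ⟩
    (f ℕ.+ g) ℕ.+ (i ℕ.+ suc j)  ≡⟨ interchange f g i (suc j) ⟩
    (f ℕ.+ i) ℕ.+ (g ℕ.+ suc j)  ≡⟨ ≡.cong ((f ℕ.+ i) ℕ.+_) (ℕ.+-suc g j) ⟩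
    (f ℕ.+ i) ℕ.+ suc (g ℕ.+ j)  ≤⟨ ℕ.+-mono-≤ f+i≤n (s≤s g+j≤n) ⟩
    n ℕ.+ suc n                  ∎)
  where
  open ℕ.≤-Reasoning
  h+i≤ : h ℕ.+ i ℕ.≤ i ℕ.+ suc j
  h+i≤ = ℕ.≤-trans (ℕ.+-monoˡ-≤ i h≤1+j) (ℕ.≤-reflexive (ℕ.+-comm (suc j) i))
  open import Algebra.Properties.CommutativeSemigroup ℕ.+-commutativeSemigroup using (interchange)

-- The equation says `d - a = b - c`; in its use these are the codimensions of an intersection in
-- one space and of the other space in the sum.
+-exchange-≤ : ∀ {a b c d} → a ℕ.+ b ≡ c ℕ.+ d → b ℕ.≤ suc c → d ℕ.≤ suc a
+-exchange-≤ {a} {b} {c} {d} eq b≤1+c = ℕ.+-cancelˡ-≤ c d (suc a) (begin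
  c ℕ.+ d      ≡⟨ eq ⟨
  a ℕ.+ b      ≤⟨ ℕ.+-monoʳ-≤ a b≤1+c ⟩
  a ℕ.+ suc c  ≡⟨ ℕ.+-comm a (suc c) ⟩
  suc c ℕ.+ a  ≡⟨ ℕ.+-suc c a ⟨
  c ℕ.+ suc a  ∎)
  where
  open ℕ.≤-Reasoning

module MatchingTheory {c ℓ k} (em : ∀ {p} → ExcludedMiddle p)
  (L : DivisionRing c ℓ) (K : Pred (DivisionRing.Carrier L) k)
  (K-isSubDivisionRing : IsSubDivisionRing L K) (K-central : IsCentral L K) where

  open DivisionRing L hiding (zero)
  open import Algebra.Properties.Ring ring
  open import Algebra.Properties.CommutativeSemigroup +-commutativeSemigroup
    using (interchange)
  open import Algebra.Properties.Semiring.Sum semiring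
    using (sum; sum-cong-≋; sum-remove; sum-replicate-zero; ∑-distrib-+)
  open import Relation.Binary.Reasoning.Setoid setoid
  private
    module K = IsSubDivisionRing K-isSubDivisionRing

  -- Classical choice of witnesses and cancellation in division rings

  dec : ∀ {p} (P : Set p) → Dec P
  dec P = em

  ¬∀⇒∃¬ : ∀ {a p} {A : Set a} {P : A → Set p} → ¬ (∀ x → P x) → ∃ λ x → ¬ P x
  ¬∀⇒∃¬ {P = P} ¬∀ with dec (∃ λ x → ¬ P x)
  ... | yes ∃¬ = ∃¬
  ... | no ¬∃¬ = ⊥-elim (¬∀ λ x → decidable-stable (dec (P x)) λ ¬Px → ¬∃¬ (x , ¬Px))

  ⊈⇒∃ : ∀ {p q} {P : Pred Carrier p} {Q : Pred Carrier q} →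
        ¬ (P ⊆ Q) → ∃ λ x → x ∈ P × x ∉ Q
  ⊈⇒∃ {P = P} {Q} ⊈ with dec (∃ λ x → x ∈ P × x ∉ Q)
  ... | yes ∃x = ∃x
  ... | no ∄x = ⊥-elim (⊈ λ {x} x∈P → decidable-stable em λ x∉Q → ∄x (x , x∈P , x∉Q))

  no-zero-divisors : ∀ {x y} → x * y ≈ 0# → ¬ (x ≈ 0#) → y ≈ 0#
  no-zero-divisors {x} {y} xy≈0 x≉0 with inverse x x≉0
  ... | x⁻¹ , x⁻¹x≈1 , _ = begin
    y               ≈⟨ *-identityˡ y ⟨
    1# * y          ≈⟨ *-congʳ x⁻¹x≈1 ⟨
    (x⁻¹ * x) * y   ≈⟨ *-assoc _ _ _ ⟩
    x⁻¹ * (x * y)   ≈⟨ *-congˡ xy≈0 ⟩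
    x⁻¹ * 0#        ≈⟨ zeroʳ _ ⟩
    0#              ∎

  inverse-∈K : ∀ {s} → s ∈ K → ¬ (s ≈ 0#) → ∃ λ t → t ∈ K × t * s ≈ 1#
  inverse-∈K {s} s∈K s≉0 with inverse s s≉0
  ... | t , ts≈1 , st≈1 = t , K.inv-closed s∈K st≈1 , ts≈1

  -- Subspaces and their dimension

  record Subspace : Set (lsuc (c ⊔ ℓ ⊔ k)) where
    constructor mkSubspace
    field
      ⟦_⟧        : Subset L K
      isSubspace : IsSubspace L K ⟦_⟧
    open IsSubspace isSubspace public

    neg-closed : ∀ {x} → x ∈ ⟦_⟧ → - x ∈ ⟦_⟧
    neg-closed {x} x∈A = resp (-1*x≈-x x) (*-closed (K.neg-closed K.1-closed) x∈A)

    +-cancelʳ-∈ : ∀ {x y} → x + y ∈ ⟦_⟧ → y ∈ ⟦_⟧ → x ∈ ⟦_⟧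
    +-cancelʳ-∈ {x} {y} x+y∈A y∈A = resp (//-rightDividesʳ y x) (+-closed x+y∈A (neg-closed y∈A))

    +-cancelˡ-∈ : ∀ {x y} → x + y ∈ ⟦_⟧ → x ∈ ⟦_⟧ → y ∈ ⟦_⟧
    +-cancelˡ-∈ {x} {y} x+y∈A = +-cancelʳ-∈ (resp (+-comm x y) x+y∈A)

    *-cancelˡ-∈ : ∀ {s x} → s ∈ K → ¬ (s ≈ 0#) → s * x ∈ ⟦_⟧ → x ∈ ⟦_⟧
    *-cancelˡ-∈ {s} {x} s∈K s≉0 sx∈A with inverse-∈K s∈K s≉0
    ... | t , t∈K , ts≈1 = resp eq (*-closed t∈K sx∈A)
      where
      eq : t * (s * x) ≈ x
      eq = trans (sym (*-assoc t s x)) (trans (*-congʳ ts≈1) (*-identityˡ x))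

    -- A nonzero `s` could be divided out. This is the standard way below to show that a coefficient
    -- vanishes: reduce a relation modulo a subspace containing all its terms but one.
    fresh⇒0 : ∀ {s x} → s ∈ K → s * x ∈ ⟦_⟧ → x ∉ ⟦_⟧ → s ≈ 0#
    fresh⇒0 s∈K sx∈A x∉A = decidable-stable em λ s≉0 → x∉A (*-cancelˡ-∈ s∈K s≉0 sx∈A)

    -- Subtracting `t * s⁻¹` times the second relation from the first cancels `x`; this is the
    -- computation behind the exchange of split vectors.
    eliminate : ∀ {x y z s t} → s ∈ K → t ∈ K → ¬ (s ≈ 0#) →
                y + t * x ∈ ⟦_⟧ → z + s * x ∈ ⟦_⟧ →
                ∃ λ r → r ∈ K × y + r * z ∈ ⟦_⟧
    eliminate {x} {y} {z} {s} {t} s∈K t∈K s≉0 y+tx∈A z+sx∈A with inverse-∈K s∈K s≉0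
    ... | s⁻¹ , s⁻¹∈K , s⁻¹s≈1 = r , r∈K , resp eq (+-closed y+tx∈A (*-closed r∈K z+sx∈A))
      where
      r = - t * s⁻¹
      r∈K = K.*-closed (K.neg-closed t∈K) s⁻¹∈K
      rs≈-t : r * s ≈ - t
      rs≈-t = trans (*-assoc _ _ _) (trans (*-congˡ s⁻¹s≈1) (*-identityʳ _))
      tx+rsx≈0 : t * x + r * (s * x) ≈ 0#
      tx+rsx≈0 = begin
        t * x + r * (s * x)  ≈⟨ +-congˡ (*-assoc r s x) ⟨
        t * x + (r * s) * x  ≈⟨ distribʳ x t (r * s) ⟨
        (t + r * s) * x      ≈⟨ *-congʳ (trans (+-congˡ rs≈-t) (-‿inverseʳ t)) ⟩
        0# * x               ≈⟨ zeroˡ x ⟩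
        0#                   ∎
      eq : (y + t * x) + r * (z + s * x) ≈ y + r * z
      eq = begin
        (y + t * x) + r * (z + s * x)          ≈⟨ +-congˡ (distribˡ r z (s * x)) ⟩
        (y + t * x) + (r * z + r * (s * x))    ≈⟨ interchange _ _ _ _ ⟩
        (y + r * z) + (t * x + r * (s * x))    ≈⟨ +-congˡ tx+rsx≈0 ⟩
        (y + r * z) + 0#                       ≈⟨ +-identityʳ _ ⟩
        y + r * z                              ∎

  open Subspace using (⟦_⟧)

  x+0y≈x : ∀ {s x} y → s ≈ 0# → x + s * y ≈ x
  x+0y≈x {s} {x} y s≈0 = trans (+-congˡ (trans (*-congʳ s≈0) (zeroˡ y))) (+-identityʳ x)

  infixr 7 _∩_
  _∩_ : Subspace → Subspace → Subspace
  A ∩ B = mkSubspace (λ x → x ∈ ⟦ A ⟧ × x ∈ ⟦ B ⟧) record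
    { resp     = λ x≈y (a , b) → A.resp x≈y a , B.resp x≈y b
    ; 0-closed = A.0-closed , B.0-closed
    ; +-closed = λ (a , b) (a′ , b′) → A.+-closed a a′ , B.+-closed b b′
    ; *-closed = λ s∈K (a , b) → A.*-closed s∈K a , B.*-closed s∈K b
    }
    where
    module A = Subspace A
    module B = Subspace B

  -- x ∈ A + B is encoded as x + b ∈ A for some b ∈ B.
  infixr 6 _⊹_
  _⊹_ : Subspace → Subspace → Subspace
  A ⊹ B = mkSubspace (λ x → ∃ λ b → b ∈ ⟦ B ⟧ × x + b ∈ ⟦ A ⟧) record
    { resp     = λ x≈y (b , b∈B , m) → b , b∈B , A.resp (+-congʳ x≈y) m
    ; 0-closed = 0# , B.0-closed , A.resp (sym (+-identityʳ 0#)) A.0-closed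
    ; +-closed = λ (b , b∈B , m) (b′ , b′∈B , m′) →
        b + b′ , B.+-closed b∈B b′∈B , A.resp (interchange _ _ _ _) (A.+-closed m m′)
    ; *-closed = λ s∈K (b , b∈B , m) →
        _ , B.*-closed s∈K b∈B , A.resp (distribˡ _ _ _) (A.*-closed s∈K m)
    }
    where
    module A = Subspace A
    module B = Subspace B

  ⊹-inˡ : ∀ A B → ⟦ A ⟧ ⊆ ⟦ A ⊹ B ⟧
  ⊹-inˡ A B x∈A = 0# , Subspace.0-closed B , Subspace.resp A (sym (+-identityʳ _)) x∈A

  ⊹-inʳ : ∀ A B → ⟦ B ⟧ ⊆ ⟦ A ⊹ B ⟧
  ⊹-inʳ A B x∈B = _ , Subspace.neg-closed B x∈B ,
    Subspace.resp A (sym (-‿inverseʳ _)) (Subspace.0-closed A)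

  ⊹-lub : ∀ A B C → ⟦ A ⟧ ⊆ ⟦ C ⟧ → ⟦ B ⟧ ⊆ ⟦ C ⟧ → ⟦ A ⊹ B ⟧ ⊆ ⟦ C ⟧
  ⊹-lub A B C A⊆C B⊆C (b , b∈B , m) = Subspace.+-cancelʳ-∈ C (A⊆C m) (B⊆C b∈B)

  line : Carrier → Subspace
  line x = mkSubspace (λ y → ∃ λ s → s ∈ K × y ≈ s * x) record
    { resp     = λ y≈z (s , s∈K , eq) → s , s∈K , trans (sym y≈z) eq
    ; 0-closed = 0# , K.0-closed , sym (zeroˡ x)
    ; +-closed = λ (s , s∈K , eq) (t , t∈K , eq′) →
        s + t , K.+-closed s∈K t∈K , trans (+-cong eq eq′) (sym (distribʳ x s t))
    ; *-closed = λ r∈K (s , s∈K , eq) →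
        _ , K.*-closed r∈K s∈K , trans (*-congˡ eq) (sym (*-assoc _ _ _))
    }

  x∈line : ∀ x → x ∈ ⟦ line x ⟧
  x∈line x = 1# , K.1-closed , sym (*-identityˡ x)

  line-⊆ : ∀ A {x} → x ∈ ⟦ A ⟧ → ⟦ line x ⟧ ⊆ ⟦ A ⟧
  line-⊆ A x∈A (s , s∈K , eq) = Subspace.resp A (sym eq) (Subspace.*-closed A s∈K x∈A)

  -- A = K x ⊕ A′; as in _⊹_, the decomposition is y + s x ∈ A′, which moves the sign into s.
  record Split (A : Subspace) (x : Carrier) (A′ : Subspace) : Set (c ⊔ ℓ ⊔ k) where
    field
      sub       : ⟦ A′ ⟧ ⊆ ⟦ A ⟧
      member    : x ∈ ⟦ A ⟧
      fresh     : x ∉ ⟦ A′ ⟧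
      decompose : ∀ {y} → y ∈ ⟦ A ⟧ → ∃ λ s → s ∈ K × y + s * x ∈ ⟦ A′ ⟧

  -- A complete flag, each term a hyperplane of the one before, so that dimension theory becomes
  -- induction along flags. That the length does not depend on the flag follows from `dim-mono`.
  data Dim : Subspace → ℕ → Set (lsuc (c ⊔ ℓ ⊔ k)) where
    zero : ∀ {A} → (∀ {x} → x ∈ ⟦ A ⟧ → x ≈ 0#) → Dim A 0
    suc  : ∀ {A x A′ n} → Split A x A′ → Dim A′ n → Dim A (suc n)

  -- Modulo `A′` the vector `a` is a multiple of `x`, and the scalar is nonzero because `a ∉ A′`.
  split-exchange : ∀ {A x A′ a} → Split A x A′ → a ∈ ⟦ A ⟧ → a ∉ ⟦ A′ ⟧ → Split A a A′
  split-exchange {A} {x} {A′} {a} S a∈A a∉A′ = record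
    { sub = S.sub ; member = a∈A ; fresh = a∉A′
    ; decompose = λ y∈A → let t , t∈K , m = S.decompose y∈A in
                          let s , s∈K , m′ = S.decompose a∈A in
        A′.eliminate s∈K t∈K (λ s≈0 → a∉A′ (A′.resp (x+0y≈x x s≈0) m′)) m m′
    }
    where
    module S = Split S
    module A′ = Subspace A′

  split-restrict : ∀ {A a A′} C → Split A a A′ → ⟦ C ⟧ ⊆ ⟦ A ⟧ → a ∈ ⟦ C ⟧ → Split C a (C ∩ A′)
  split-restrict {A} {a} {A′} C S C⊆A a∈C = record
    { sub = proj₁ ; member = a∈C ; fresh = S.fresh ∘ proj₂
    ; decompose = λ y∈C → let s , s∈K , m = S.decompose (C⊆A y∈C) in
        s , s∈K , C.+-closed y∈C (C.*-closed s∈K a∈C) , m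
    }
    where
    module S = Split S
    module C = Subspace C

  split-⊆ : ∀ {A x A′} C → Split A x A′ → ⟦ A′ ⟧ ⊆ ⟦ C ⟧ → x ∈ ⟦ C ⟧ → ⟦ A ⟧ ⊆ ⟦ C ⟧
  split-⊆ C S A′⊆C x∈C y∈A with Split.decompose S y∈A
  ... | s , s∈K , m = Subspace.+-cancelʳ-∈ C (A′⊆C m) (Subspace.*-closed C s∈K x∈C)

  split-respˡ : ∀ {A B x A′} → ⟦ A ⟧ ⊆ ⟦ B ⟧ → ⟦ B ⟧ ⊆ ⟦ A ⟧ → Split A x A′ → Split B x A′
  split-respˡ A⊆B B⊆A S = record
    { sub = A⊆B ∘ S.sub ; member = A⊆B S.member ; fresh = S.fresh ; decompose = S.decompose ∘ B⊆A }
    where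
    module S = Split S

  split-line : ∀ A {x} → x ∉ ⟦ A ⟧ → Split (A ⊹ line x) x A
  split-line A {x} x∉A = record
    { sub = ⊹-inˡ A (line x) ; member = ⊹-inʳ A (line x) (x∈line x) ; fresh = x∉A
    ; decompose = λ (b , (s , s∈K , b≈sx) , m) → s , s∈K , Subspace.resp A (+-congˡ b≈sx) m }

  dim-resp : ∀ {A B n} → ⟦ A ⟧ ⊆ ⟦ B ⟧ → ⟦ B ⟧ ⊆ ⟦ A ⟧ → Dim A n → Dim B n
  dim-resp A⊆B B⊆A (zero A≈0) = zero (A≈0 ∘ B⊆A)
  dim-resp A⊆B B⊆A (suc S d)  = suc (split-respˡ A⊆B B⊆A S) d

  -- Intersects `C` with the flag of `A`. Whenever `C` leaves the next term `A′`, an element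
  -- witnessing this replaces the split vector, and the recursion continues with `C ∩ A′`.
  dim-sub : ∀ {A n} C → Dim A n → ⟦ C ⟧ ⊆ ⟦ A ⟧ → ∃ λ m → Dim C m
  dim-sub C (zero A≈0) C⊆A = 0 , zero (A≈0 ∘ C⊆A)
  dim-sub C (suc {A′ = A′} S d) C⊆A with dec (⟦ C ⟧ ⊆ ⟦ A′ ⟧)
  ... | yes C⊆A′ = dim-sub C d C⊆A′
  ... | no C⊈A′ with ⊈⇒∃ C⊈A′ | dim-sub (C ∩ A′) d proj₂
  ...   | a , a∈C , a∉A′ | m , d′ =
    suc m , suc (split-restrict C (split-exchange S (C⊆A a∈C) a∉A′) C⊆A a∈C) d′

  -- All hyperplanes of `A` have equal dimension: if `A′` and `C` differ, `C ∩ A′` is a hyperplane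
  -- in both, and the induction hypothesis for `A′` gives its dimension.
  dim-split : ∀ {A n y C} → Dim A (suc n) → Split A y C → Dim C n
  dim-split {A} {n} {y} {C} (suc {A′ = A′} S d) T with dec (⟦ C ⟧ ⊆ ⟦ A′ ⟧)
  ... | yes C⊆A′ = dim-resp A′⊆C C⊆A′ d
    where
    module A′ = Subspace A′
    module C = Subspace C
    y∉A′ : y ∉ ⟦ A′ ⟧
    y∉A′ y∈A′ = Split.fresh S (split-⊆ A′ T C⊆A′ y∈A′ (Split.member S))
    A′⊆C : ⟦ A′ ⟧ ⊆ ⟦ C ⟧
    A′⊆C a∈A′ with Split.decompose T (Split.sub S a∈A′)
    ... | s , s∈K , m = C.resp (x+0y≈x y (A′.fresh⇒0 s∈K (A′.+-cancelˡ-∈ (C⊆A′ m) a∈A′) y∉A′)) m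
  ... | no C⊈A′ with ⊈⇒∃ C⊈A′
  ...   | a , a∈C , a∉A′ = step d (⊈⇒∃ A′⊈C)
    where
    S′ : Split A a A′
    S′ = split-exchange S (Split.sub T a∈C) a∉A′
    A′⊈C : ¬ (⟦ A′ ⟧ ⊆ ⟦ C ⟧)
    A′⊈C A′⊆C = Split.fresh T (split-⊆ C S′ A′⊆C a∈C (Split.member T))
    step : ∀ {n} → Dim A′ n → (∃ λ b → b ∈ ⟦ A′ ⟧ × b ∉ ⟦ C ⟧) → Dim C n
    step (zero A′≈0) (b , b∈A′ , b∉C) =
      contradiction (Subspace.resp C (sym (A′≈0 b∈A′)) (Subspace.0-closed C)) b∉C
    step d@(suc _ _) (b , b∈A′ , b∉C) =
      suc (split-restrict C S′ (Split.sub T) a∈C)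
          (dim-resp (λ (x , y) → y , x) (λ (x , y) → y , x)
            (dim-split d (split-restrict A′ (split-exchange T (Split.sub S b∈A′) b∉C) (Split.sub S) b∈A′)))

  -- Induction on the flag of `B`. If `A` is not inside `B′`, one element of `A` splits off from
  -- both spaces, leaving `A ∩ B′` inside `B′`; `dim-split` gives the dimension of `A ∩ B′`.
  dim-mono : ∀ {A B m n} → Dim A m → Dim B n → ⟦ A ⟧ ⊆ ⟦ B ⟧ → m ℕ.≤ n
  dim-mono (zero _) _ _ = z≤n
  dim-mono {A} (suc {A′ = A′} S d) (zero B≈0) A⊆B = contradiction
    (Subspace.resp A′ (sym (B≈0 (A⊆B (Split.member S)))) (Subspace.0-closed A′)) (Split.fresh S)
  dim-mono {A} dA@(suc _ _) (suc {A′ = B′} T e) A⊆B with dec (⟦ A ⟧ ⊆ ⟦ B′ ⟧)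
  ... | yes A⊆B′ = ℕ.m≤n⇒m≤1+n (dim-mono dA e A⊆B′)
  ... | no A⊈B′ with ⊈⇒∃ A⊈B′
  ...   | a , a∈A , a∉B′ = s≤s (dim-mono
    (dim-split dA (split-restrict A (split-exchange T (A⊆B a∈A) a∉B′) A⊆B a∈A)) e proj₂)

  dim-⊂ : ∀ {A B m n x} → Dim A m → Dim B n → ⟦ A ⟧ ⊆ ⟦ B ⟧ → x ∈ ⟦ B ⟧ → x ∉ ⟦ A ⟧ → m ℕ.< n
  dim-⊂ {A} {B} {x = x} d e A⊆B x∈B x∉A =
    dim-mono (suc (split-line A x∉A) d) e (⊹-lub A (line x) B A⊆B (line-⊆ B x∈B))

  -- Induction on the flag of `B`: adding `x` to `B′` raises the dimension of the intersection if
  -- `x ∈ A + B′`, and that of the sum otherwise.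
  modular : ∀ {A B a b} → Dim A a → Dim B b →
            ∃ λ d → ∃ λ e → Dim (A ∩ B) d × Dim (A ⊹ B) e × d ℕ.+ e ≡ a ℕ.+ b
  modular {A} {B} {a} dA (zero B≈0) = 0 , a , zero (B≈0 ∘ proj₂) ,
    dim-resp (⊹-inˡ A B) (λ (b , b∈B , m) →
      Subspace.resp A (trans (+-congˡ (B≈0 b∈B)) (+-identityʳ _)) m) dA ,
    ≡.sym (ℕ.+-identityʳ a)
  modular {A} {B} {a} dA (suc {x = x} {A′ = B′} {n = b} S dB′)
    with modular dA dB′ | dec (x ∈ ⟦ A ⊹ B′ ⟧)
  ... | d , e , D , E , eq | yes (b′ , b′∈B′ , y∈A) =
    suc d , e , suc splits D , dim-resp incl₁ incl₂ E ,
    ≡.trans (≡.cong suc eq) (≡.sym (ℕ.+-suc a b))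
    where
    module B = Subspace B
    module S = Split S
    -- The vector `x` may lie outside `A`; this translate of it by an element of `B′` lies in
    -- `A ∩ B` and still avoids `B′`.
    y = x + b′
    y∉B′ : y ∉ ⟦ B′ ⟧
    y∉B′ m = S.fresh (Subspace.+-cancelʳ-∈ B′ m b′∈B′)
    y∈B : y ∈ ⟦ B ⟧
    y∈B = B.+-closed S.member (S.sub b′∈B′)
    T : Split (A ∩ B) y ((A ∩ B) ∩ B′)
    T = split-restrict (A ∩ B) (split-exchange S y∈B y∉B′) proj₂ (y∈A , y∈B)
    splits : Split (A ∩ B) y (A ∩ B′)
    splits = record
      { sub = λ (p , q) → p , S.sub q ; member = y∈A , y∈B ; fresh = y∉B′ ∘ proj₂
      ; decompose = λ m → let s , s∈K , ((p , _) , q) = Split.decompose T m in s , s∈K , p , q }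
    incl₁ : ⟦ A ⊹ B′ ⟧ ⊆ ⟦ A ⊹ B ⟧
    incl₁ (b , b∈B′ , m) = b , S.sub b∈B′ , m
    incl₂ : ⟦ A ⊹ B ⟧ ⊆ ⟦ A ⊹ B′ ⟧
    incl₂ = ⊹-lub A B (A ⊹ B′) (⊹-inˡ A B′)
      (split-⊆ (A ⊹ B′) S (⊹-inʳ A B′) (b′ , b′∈B′ , y∈A))
  ... | d , e , D , E , eq | no x∉ =
    d , suc e , dim-resp incl₁ incl₂ D , suc splits E ,
    ≡.trans (ℕ.+-suc d e) (≡.trans (≡.cong suc eq) (≡.sym (ℕ.+-suc a b)))
    where
    module B = Subspace B
    module S = Split S
    module A+B′ = Subspace (A ⊹ B′)
    incl₁ : ⟦ A ∩ B′ ⟧ ⊆ ⟦ A ∩ B ⟧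
    incl₁ (p , q) = p , S.sub q
    incl₂ : ⟦ A ∩ B ⟧ ⊆ ⟦ A ∩ B′ ⟧
    incl₂ (p , q) with S.decompose q
    ... | s , s∈K , m = p , Subspace.resp B′ (x+0y≈x x (A+B′.fresh⇒0 s∈K
      (A+B′.+-cancelˡ-∈ (⊹-inʳ A B′ m) (⊹-inˡ A B′ p)) x∉)) m
    splits : Split (A ⊹ B) x (A ⊹ B′)
    splits = record
      { sub = λ (b , b∈B′ , m) → b , S.sub b∈B′ , m
      ; member = ⊹-inʳ A B S.member ; fresh = x∉
      ; decompose = λ {y} (b , b∈B , m) → let s , s∈K , q = S.decompose b∈B in
          - s , K.neg-closed s∈K , b + s * x , q , Subspace.resp A (regroup y b s) m
      }
      where
      regroup : ∀ y b s → y + b ≈ (y + - s * x) + (b + s * x)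
      regroup y b s = begin
        y + b                            ≈⟨ +-identityʳ _ ⟨
        (y + b) + 0#                     ≈⟨ +-congˡ (zeroˡ x) ⟨
        (y + b) + 0# * x                 ≈⟨ +-congˡ (*-congʳ (-‿inverseˡ s)) ⟨
        (y + b) + (- s + s) * x          ≈⟨ +-congˡ (distribʳ x (- s) s) ⟩
        (y + b) + (- s * x + s * x)      ≈⟨ interchange _ _ _ _ ⟩
        (y + - s * x) + (b + s * x)      ∎

  dim-≥⇒⊆ : ∀ {A B m n} → Dim A m → Dim B n → n ℕ.≤ m → ⟦ A ⟧ ⊆ ⟦ B ⟧ → ⟦ B ⟧ ⊆ ⟦ A ⟧
  dim-≥⇒⊆ d e n≤m A⊆B x∈B =
    decidable-stable em λ x∉A → ℕ.<⇒≱ (dim-⊂ d e A⊆B x∈B x∉A) n≤m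

  -- Spans and bases

  zeroSubspace : Subspace
  zeroSubspace = mkSubspace (λ x → Lift (c ⊔ ℓ ⊔ k) (x ≈ 0#)) record
    { resp     = λ x≈y (lift x≈0) → lift (trans (sym x≈y) x≈0)
    ; 0-closed = lift refl
    ; +-closed = λ (lift x≈0) (lift y≈0) → lift (trans (+-cong x≈0 y≈0) (+-identityʳ 0#))
    ; *-closed = λ _ (lift x≈0) → lift (trans (*-congˡ x≈0) (zeroʳ _))
    }

  sum-closed : ∀ A {n} (s v : Vector Carrier n) → (∀ i → s i ∈ K) → (∀ i → v i ∈ ⟦ A ⟧) →
               sum (λ i → s i * v i) ∈ ⟦ A ⟧
  sum-closed A {zero}  s v s∈K v∈A = Subspace.0-closed A
  sum-closed A {suc n} s v s∈K v∈A = Subspace.+-closed A (Subspace.*-closed A (s∈K zero) (v∈A zero))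
    (sum-closed A (tail s) (tail v) (s∈K ∘ suc) (v∈A ∘ suc))

  -- The recursive form turns independent vectors into a flag directly. `Span⇒span` and `span⇒Span`
  -- identify it with the description by coefficients.
  span : ∀ {n} → Vector Carrier n → Subspace
  span {zero}  v = zeroSubspace
  span {suc n} v = span (tail v) ⊹ line (head v)

  ∈-span : ∀ {n} (v : Vector Carrier n) i → v i ∈ ⟦ span v ⟧
  ∈-span v zero    = ⊹-inʳ (span (tail v)) (line (head v)) (x∈line (head v))
  ∈-span v (suc i) = ⊹-inˡ (span (tail v)) (line (head v)) (∈-span (tail v) i)

  span-⊆ : ∀ A {n} (v : Vector Carrier n) → (∀ i → v i ∈ ⟦ A ⟧) → ⟦ span v ⟧ ⊆ ⟦ A ⟧
  span-⊆ A {zero}  v v∈A (lift x≈0) = Subspace.resp A (sym x≈0) (Subspace.0-closed A)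
  span-⊆ A {suc n} v v∈A =
    ⊹-lub (span (tail v)) (line (head v)) A (span-⊆ A (tail v) (v∈A ∘ suc)) (line-⊆ A (v∈A zero))

  Span⇒span : ∀ {n} (v : Vector Carrier n) → Span L K v ⊆ ⟦ span v ⟧
  Span⇒span v (s , s∈K , x≈) =
    Subspace.resp (span v) (sym x≈) (sum-closed (span v) s v s∈K (∈-span v))

  Span-cons : ∀ {n} (v : Vector Carrier (suc n)) {x s} → s ∈ K →
              x + s * v zero ∈ Span L K (tail v) → x ∈ Span L K v
  Span-cons v {x} {s} s∈K (t , t∈K , x+≈) =
    (- s ∷ᵛ t) , (λ { zero → K.neg-closed s∈K ; (suc i) → t∈K i }) , (begin
    x                                     ≈⟨ //-rightDividesʳ (s * v zero) x ⟨
    (x + s * v zero) + - (s * v zero)     ≈⟨ +-comm _ _ ⟩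
    - (s * v zero) + (x + s * v zero)     ≈⟨ +-cong (-‿distribˡ-* s (v zero)) x+≈ ⟩
    - s * v zero + sum (λ i → t i * v (suc i))  ∎)

  span⇒Span : ∀ {n} (v : Vector Carrier n) → ⟦ span v ⟧ ⊆ Span L K v
  span⇒Span {zero}  v (lift x≈0) = []ᵛ , (λ ()) , x≈0
  span⇒Span {suc n} v (b , (s , s∈K , b≈) , m) = Span-cons v s∈K
    (span⇒Span (tail v) (Subspace.resp (span (tail v)) (+-congˡ b≈) m))

  0≉-1 : ¬ (- 1# ≈ 0#)
  0≉-1 -1≈0 = 0≉1 (begin
    0#         ≈⟨ -0#≈0# ⟨
    - 0#       ≈⟨ -‿cong -1≈0 ⟨
    - (- 1#)   ≈⟨ -‿involutive 1# ⟩
    1#         ∎)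

  independent-tail : ∀ {n} (v : Vector Carrier (suc n)) →
                     LinearlyIndependent L K v → LinearlyIndependent L K (tail v)
  independent-tail v ind s s∈K eq i = ind (0# ∷ᵛ s) (λ { zero → K.0-closed ; (suc j) → s∈K j })
    (trans (+-cong (zeroˡ _) eq) (+-identityʳ 0#)) (suc i)

  head∉span-tail : ∀ {n} (v : Vector Carrier (suc n)) →
                   LinearlyIndependent L K v → head v ∉ ⟦ span (tail v) ⟧
  head∉span-tail v ind m with span⇒Span (tail v) m
  ... | t , t∈K , eq = 0≉-1 (ind (- 1# ∷ᵛ t)
    (λ { zero → K.neg-closed K.1-closed ; (suc j) → t∈K j })
    (trans (+-cong (-1*x≈-x _) (sym eq)) (-‿inverseˡ _)) zero)

  independent⇒Dim : ∀ {n} (v : Vector Carrier n) → LinearlyIndependent L K v → Dim (span v) n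
  independent⇒Dim {zero}  v ind = zero λ (lift x≈0) → x≈0
  independent⇒Dim {suc n} v ind = suc (split-line (span (tail v)) (head∉span-tail v ind))
    (independent⇒Dim (tail v) (independent-tail v ind))

  basis⇒Dim : ∀ A {n} {v : Vector Carrier n} → IsBasis L K ⟦ A ⟧ v → Dim A n
  basis⇒Dim A {v = v} isBasis = dim-resp (span-⊆ A v B.members) (Span⇒span v ∘ B.spanning)
    (independent⇒Dim v B.independent)
    where
    module B = IsBasis isBasis

  Dim⇒basis : ∀ {A n} → Dim A n → Σ[ v ∈ Vector Carrier n ] IsBasis L K ⟦ A ⟧ v
  Dim⇒basis (zero A≈0) = []ᵛ , record
    { members = λ () ; independent = λ _ _ _ () ; spanning = λ x∈A → []ᵛ , (λ ()) , A≈0 x∈A }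
  Dim⇒basis (suc {A} {x} {A′} S d) with Dim⇒basis d
  ... | v , isBasis = (x ∷ᵛ v) , record
    { members     = λ { zero → S.member ; (suc i) → S.sub (B.members i) }
    ; independent = ind
    ; spanning    = λ y∈A → let s , s∈K , m = S.decompose y∈A in
                            Span-cons (x ∷ᵛ v) s∈K (B.spanning m)
    }
    where
    module S = Split S
    module B = IsBasis isBasis
    module A′ = Subspace A′
    ind : LinearlyIndependent L K (x ∷ᵛ v)
    ind s s∈K eq = λ { zero → s₀≈0 ; (suc i) → B.independent (tail s) (s∈K ∘ suc) tail≈0 i }
      where
      s₀≈0 : s zero ≈ 0#
      s₀≈0 = A′.fresh⇒0 (s∈K zero) (A′.+-cancelʳ-∈ (A′.resp (sym eq) A′.0-closed)
        (sum-closed A′ (tail s) v (s∈K ∘ suc) B.members)) S.fresh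
      tail≈0 : sum (λ i → s (suc i) * v i) ≈ 0#
      tail≈0 = trans (sym (trans (+-comm _ _) (x+0y≈x x s₀≈0))) eq

  Dim⇒HasDimension : ∀ {A n} → Dim A n → HasDimension L K ⟦ A ⟧ n
  Dim⇒HasDimension {A} d = record { isSubspace = Subspace.isSubspace A ; hasBasis = Dim⇒basis d }

  independent⇒basis : ∀ {A n} {v : Vector Carrier n} → Dim A n → LinearlyIndependent L K v →
                      (∀ i → v i ∈ ⟦ A ⟧) → IsBasis L K ⟦ A ⟧ v
  independent⇒basis {A} {v = v} d ind v∈A = record
    { members = v∈A ; independent = ind
    ; spanning = span⇒Span v ∘ dim-≥⇒⊆ (independent⇒Dim v ind) d ℕ.≤-refl (span-⊆ A v v∈A) }

  -- Preimages under multiplication maps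

  record Linear (φ : Carrier → Carrier) : Set (c ⊔ ℓ ⊔ k) where
    field
      φ-cong : ∀ {x y} → x ≈ y → φ x ≈ φ y
      φ-+    : ∀ x y → φ (x + y) ≈ φ x + φ y
      φ-*    : ∀ {s} x → s ∈ K → φ (s * x) ≈ s * φ x
      φ-0    : φ 0# ≈ 0#

  -- Translates such as `x⁻¹ A` or `V e` are encoded as preimages under multiplication maps, so that
  -- membership carries no witness.
  preimage : ∀ {φ} → Linear φ → Subspace → Subspace
  preimage {φ} lin A = mkSubspace (λ x → φ x ∈ ⟦ A ⟧) record
    { resp     = A.resp ∘ φ-cong
    ; 0-closed = A.resp (sym φ-0) A.0-closed
    ; +-closed = λ p q → A.resp (sym (φ-+ _ _)) (A.+-closed p q)
    ; *-closed = λ s∈K p → A.resp (sym (φ-* _ s∈K)) (A.*-closed s∈K p)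
    }
    where
    module A = Subspace A
    open Linear lin

  dim-preimage : ∀ {φ A n} (lin : Linear φ) (ψ : Carrier → Carrier) →
                 (∀ x → φ (ψ x) ≈ x) → (∀ {x} → φ x ≈ 0# → x ≈ 0#) →
                 Dim A n → Dim (preimage lin A) n
  dim-preimage lin ψ φψ φ-inj (zero A≈0) = zero (φ-inj ∘ A≈0)
  dim-preimage lin ψ φψ φ-inj (suc {A} {x} {A′} S d) = suc record
    { sub = S.sub
    ; member = Subspace.resp A (sym (φψ x)) S.member
    ; fresh = S.fresh ∘ A′.resp (φψ x)
    ; decompose = λ {y} m → let s , s∈K , q = S.decompose m in s , s∈K ,
        A′.resp (sym (trans (φ-+ y _) (+-congˡ (trans (φ-* (ψ x) s∈K) (*-congˡ (φψ x)))))) q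
    } (dim-preimage lin ψ φψ φ-inj d)
    where
    module S = Split S
    module A′ = Subspace A′
    open Linear lin

  -- Scalars act on the left, so extracting one from `x * (s * z)` moves it past `x`; centrality of
  -- `K` enters here.
  left-mul : ∀ x → Linear (x *_)
  left-mul x = record
    { φ-cong = *-congˡ ; φ-+ = distribˡ x ; φ-0 = zeroʳ x
    ; φ-* = λ z s∈K → trans (sym (*-assoc _ _ _))
        (trans (*-congʳ (sym (K-central s∈K x))) (*-assoc _ _ _)) }

  right-mul : ∀ x → Linear (_* x)
  right-mul x = record
    { φ-cong = *-congʳ ; φ-+ = distribʳ x ; φ-0 = zeroˡ x ; φ-* = λ z s∈K → *-assoc _ _ _ }

  Unit : Carrier → Carrier → Set ℓ
  Unit x y = x * y ≈ 1# × y * x ≈ 1#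

  cancelˡ : ∀ {a b} → a * b ≈ 1# → ∀ z → a * (b * z) ≈ z
  cancelˡ ab≈1 z = trans (sym (*-assoc _ _ _)) (trans (*-congʳ ab≈1) (*-identityˡ z))

  cancelʳ : ∀ {a b} → a * b ≈ 1# → ∀ z → (z * a) * b ≈ z
  cancelʳ ab≈1 z = trans (*-assoc _ _ _) (trans (*-congˡ ab≈1) (*-identityʳ z))

  dim-left-mul : ∀ {x y A n} → Unit x y → Dim A n → Dim (preimage (left-mul x) A) n
  dim-left-mul {x} {y} (xy≈1 , yx≈1) = dim-preimage (left-mul x) (y *_) (cancelˡ xy≈1)
    λ eq → trans (sym (cancelˡ yx≈1 _)) (trans (*-congˡ eq) (zeroʳ y))

  dim-right-mul : ∀ {x y A n} → Unit x y → Dim A n → Dim (preimage (right-mul x) A) n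
  dim-right-mul {x} {y} (xy≈1 , yx≈1) = dim-preimage (right-mul x) (_* y) (cancelʳ yx≈1)
    λ eq → trans (sym (cancelʳ xy≈1 _)) (trans (*-congʳ eq) (zeroˡ y))

  -- Finite-dimensional subspaces bundled with a flag

  record FinSubspace : Set (lsuc (c ⊔ ℓ ⊔ k)) where
    constructor mkFin
    field
      {space} : Subspace
      {dim}   : ℕ
      hasDim  : Dim space dim
    open Subspace space public

  open FinSubspace using (dim; hasDim; space)

  infix 4 _∈ᶠ_ _∉ᶠ_ _⊆ᶠ_
  _∈ᶠ_ _∉ᶠ_ : Carrier → FinSubspace → Set (c ⊔ ℓ ⊔ k)
  x ∈ᶠ A = x ∈ ⟦ space A ⟧
  x ∉ᶠ A = ¬ x ∈ᶠ A

  _⊆ᶠ_ : FinSubspace → FinSubspace → Set (c ⊔ ℓ ⊔ k)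
  A ⊆ᶠ B = ∀ {x} → x ∈ᶠ A → x ∈ᶠ B

  infixr 7 _∩ᶠ_
  infixr 6 _⊹ᶠ_
  _∩ᶠ_ _⊹ᶠ_ : FinSubspace → FinSubspace → FinSubspace
  A ∩ᶠ B = mkFin (proj₁ (proj₂ (proj₂ (modular (hasDim A) (hasDim B)))))
  A ⊹ᶠ B = mkFin (proj₁ (proj₂ (proj₂ (proj₂ (modular (hasDim A) (hasDim B))))))

  dim-∩-⊹ : ∀ A B → dim (A ∩ᶠ B) ℕ.+ dim (A ⊹ᶠ B) ≡ dim A ℕ.+ dim B
  dim-∩-⊹ A B = proj₂ (proj₂ (proj₂ (proj₂ (modular (hasDim A) (hasDim B)))))

  left-preimage right-preimage : ∀ {x y} → Unit x y → FinSubspace → FinSubspace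
  left-preimage x-unit A  = mkFin (dim-left-mul x-unit (hasDim A))
  right-preimage x-unit A = mkFin (dim-right-mul x-unit (hasDim A))

  dim-≤ : ∀ {A B} → A ⊆ᶠ B → dim A ℕ.≤ dim B
  dim-≤ {A} {B} = dim-mono (hasDim A) (hasDim B)

  dim-< : ∀ {A B x} → A ⊆ᶠ B → x ∈ᶠ B → x ∉ᶠ A → dim A ℕ.< dim B
  dim-< {A} {B} = dim-⊂ (hasDim A) (hasDim B)

  dim-nonzero : ∀ A {x} → x ∈ᶠ A → ¬ (x ≈ 0#) → 1 ℕ.≤ dim A
  dim-nonzero A x∈A x≉0 =
    dim-⊂ (zero {A = zeroSubspace} λ (lift x≈0) → x≈0) (hasDim A)
      (λ (lift x≈0) → FinSubspace.resp A (sym x≈0) (FinSubspace.0-closed A)) x∈A (x≉0 ∘ λ (lift x≈0) → x≈0)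

  nonzero-element : ∀ A → 1 ℕ.≤ dim A → ∃ λ x → x ∈ᶠ A × ¬ (x ≈ 0#)
  nonzero-element (mkFin (suc {A′ = A′} S d)) _ = _ , Split.member S , λ x≈0 →
    Split.fresh S (Subspace.resp A′ (sym x≈0) (Subspace.0-closed A′))

  unit : ∀ {x} → ¬ (x ≈ 0#) → ∃ (Unit x)
  unit x≉0 with inverse _ x≉0
  ... | y , yx≈1 , xy≈1 = y , xy≈1 , yx≈1

  dim-line : ∀ x → ¬ (x ≈ 0#) → Dim (line x) 1
  dim-line x x≉0 = suc {A′ = zeroSubspace} record
    { sub = λ (lift y≈0) → 0# , K.0-closed , trans y≈0 (sym (zeroˡ x))
    ; member = x∈line x
    ; fresh = λ (lift x≈0) → x≉0 x≈0
    ; decompose = λ (s , s∈K , y≈sx) → - s , K.neg-closed s∈K ,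
        lift (trans (+-cong y≈sx (sym (-‿distribˡ-* s x))) (-‿inverseʳ (s * x)))
    } (zero λ (lift x≈0) → x≈0)

  -- For nonzero `x` in `H`, closure gives `H ⊆ x⁻¹ H`. The dimensions agree, so the two spaces
  -- coincide, and `x⁻¹ H` contains the inverse of `x` because `1#` is in `H`.
  multiplicative⇒subDivisionRing : ∀ H → 1# ∈ᶠ H → (∀ {x y} → x ∈ᶠ H → y ∈ᶠ H → x * y ∈ᶠ H) →
                                   IsSubDivisionRing L ⟦ space H ⟧
  multiplicative⇒subDivisionRing H 1∈H mult = record
    { resp = H.resp ; 0-closed = H.0-closed ; 1-closed = 1∈H ; +-closed = H.+-closed
    ; neg-closed = H.neg-closed ; *-closed = mult ; inv-closed = inv-closed }
    where
    module H = FinSubspace H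
    inv-closed : ∀ {x y} → x ∈ᶠ H → x * y ≈ 1# → y ∈ᶠ H
    inv-closed {x} {y} x∈H xy≈1 =
      dim-≥⇒⊆ (hasDim H) (hasDim (left-preimage x-unit H)) ℕ.≤-refl (mult x∈H) (H.resp (sym xy≈1) 1∈H)
      where
      x-unit = proj₂ (unit {x} λ x≈0 → 0≉1 (trans (sym (zeroˡ y)) (trans (*-congʳ (sym x≈0)) xy≈1)))

  NoIntermediate : Set _
  NoIntermediate = ¬ (Σ[ M ∈ Subset L K ]
    (IsSubDivisionRing L M × K ⊂ M × M ⊂ U × FiniteDimensional L K M))

  ProductIn : FinSubspace → FinSubspace → FinSubspace → Set (c ⊔ ℓ ⊔ k)
  ProductIn V W A = ∀ {v w} → v ∈ᶠ V → w ∈ᶠ W → v * w ∈ᶠ A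

  -- Linear Cauchy–Davenport inequality

  module _ (no-intermediate : NoIntermediate) where

    -- Otherwise `H` would be an intermediate division ring: dimension at least 2 excludes `H ⊆ K`,
    -- since `K` is the line through `1#`, and `z` excludes `H = L`.
    not-multiplicative : ∀ H {z} → 1# ∈ᶠ H → 2 ℕ.≤ dim H → z ∉ᶠ H →
                         ∃ λ x → ∃ λ y → x ∈ᶠ H × y ∈ᶠ H × x * y ∉ᶠ H
    not-multiplicative H {z} 1∈H 2≤dim z∉H = decidable-stable em λ ∄xy → no-intermediate
      ( ⟦ space H ⟧
      , multiplicative⇒subDivisionRing H 1∈H (λ x∈H y∈H → decidable-stable em λ xy∉H →
          ∄xy (_ , _ , x∈H , y∈H , xy∉H))
      , ((λ s∈K → H.resp (*-identityʳ _) (H.*-closed s∈K 1∈H)) , λ H⊆K → ℕ.<⇒≱ 2≤dim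
          (dim-≤ {H} {mkFin (dim-line 1# (0≉1 ∘ sym))} λ x∈H → _ , H⊆K x∈H , sym (*-identityʳ _)))
      , ((λ _ → tt) , λ U⊆H → z∉H (U⊆H tt))
      , dim H , Dim⇒HasDimension (hasDim H) )
      where
      module H = FinSubspace H

    -- The space `v⁻¹ V` contains `1#`, so it has elements `x`, `y` whose product leaves it; `e` is
    -- `y`. Then `v * e ∈ V` makes `V ∩ V e` nonzero, and `(v * x) * e ∉ V` makes `V + V e` larger
    -- than `V`.
    right-unstable : ∀ V {z} → 2 ℕ.≤ dim V → z ∉ᶠ V →
      ∃ λ e → (∃ λ v → v ∈ᶠ V × ¬ (v ≈ 0#) × v * e ∈ᶠ V) × (∃ λ x → x ∈ᶠ V × x * e ∉ᶠ V)
    right-unstable V {z} 2≤dim z∉V with nonzero-element V (ℕ.≤-trans (ℕ.n≤1+n 1) 2≤dim)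
    ... | v , v∈V , v≉0 with unit v≉0
    ...   | v⁻¹ , vv⁻¹≈1 , v⁻¹v≈1
      with not-multiplicative (left-preimage (vv⁻¹≈1 , v⁻¹v≈1) V) {v⁻¹ * z}
             (V.resp (sym (*-identityʳ v)) v∈V) 2≤dim
             (λ m → z∉V (V.resp (cancelˡ vv⁻¹≈1 z) m))
      where
      module V = FinSubspace V
    ...     | x , y , x∈H , y∈H , xy∉H =
      y , (v , v∈V , v≉0 , y∈H) , (v * x , x∈H , xy∉H ∘ FinSubspace.resp V (*-assoc _ _ _))

    left-unstable : ∀ W {z} → 2 ℕ.≤ dim W → z ∉ᶠ W →
      ∃ λ e → (∃ λ w → w ∈ᶠ W × ¬ (w ≈ 0#) × e * w ∈ᶠ W) × (∃ λ x → x ∈ᶠ W × e * x ∉ᶠ W)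
    left-unstable W {z} 2≤dim z∉W with nonzero-element W (ℕ.≤-trans (ℕ.n≤1+n 1) 2≤dim)
    ... | w , w∈W , w≉0 with unit w≉0
    ...   | w⁻¹ , ww⁻¹≈1 , w⁻¹w≈1
      with not-multiplicative (right-preimage (ww⁻¹≈1 , w⁻¹w≈1) W) {z * w⁻¹}
             (W.resp (sym (*-identityˡ w)) w∈W) 2≤dim
             (λ m → z∉W (W.resp (cancelʳ w⁻¹w≈1 z) m))
      where
      module W = FinSubspace W
    ...     | x , y , x∈H , y∈H , xy∉H =
      x , (w , w∈W , w≉0 , x∈H) , (y * w , y∈H , xy∉H ∘ FinSubspace.resp W (sym (*-assoc _ _ _)))

    module _ (A : FinSubspace) {z : Carrier} (z∉A : z ∉ᶠ A) where
      private
        module A = FinSubspace A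
        D = dim A

      -- `V·e` consists of the `x` with `x * e⁻¹ ∈ V`, and `e⁻¹·W` of those with `e * x ∈ W`.
      -- Products of `V e` with `e⁻¹ W` are products of `V` with `W`; in each transformed pair the
      -- intersection factor can therefore be multiplied by both summands of the other factor.
      module Transform {e e⁻¹} (e-unit : Unit e e⁻¹) (V W : FinSubspace) (VW⊆A : ProductIn V W A) where
        V·e e⁻¹·W : FinSubspace
        V·e   = right-preimage (proj₂ e-unit , proj₁ e-unit) V
        e⁻¹·W = left-preimage e-unit W

        product : ∀ {v w} → v ∈ᶠ V·e → w ∈ᶠ e⁻¹·W → v * w ∈ᶠ A
        product {v} {w} v∈ w∈ = A.resp eq (VW⊆A v∈ w∈)
          where
          eq : (v * e⁻¹) * (e * w) ≈ v * w
          eq = begin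
            (v * e⁻¹) * (e * w)  ≈⟨ *-assoc v e⁻¹ _ ⟩
            v * (e⁻¹ * (e * w))  ≈⟨ *-congˡ (*-assoc e⁻¹ e w) ⟨
            v * ((e⁻¹ * e) * w)  ≈⟨ *-congˡ (*-congʳ (proj₂ e-unit)) ⟩
            v * (1# * w)         ≈⟨ *-congˡ (*-identityˡ w) ⟩
            v * w                ∎

        ∩-⊹-product : ProductIn (V ∩ᶠ V·e) (W ⊹ᶠ e⁻¹·W) A
        ∩-⊹-product (v∈V , v∈V·e) (b , b∈ , w+b∈W) =
          A.+-cancelʳ-∈ (A.resp (distribˡ _ _ _) (VW⊆A v∈V w+b∈W)) (product v∈V·e b∈)

        ⊹-∩-product : ProductIn (V ⊹ᶠ V·e) (W ∩ᶠ e⁻¹·W) A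
        ⊹-∩-product (b , b∈ , v+b∈V) (w∈W , w∈e⁻¹·W) =
          A.+-cancelʳ-∈ (A.resp (distribʳ _ _ _) (VW⊆A v+b∈V w∈W)) (product b∈ w∈e⁻¹·W)

      -- For nonzero `w ∈ W`, `V` lies in `A w⁻¹`, which has dimension `D` and omits `z * w⁻¹`. The
      -- omitted element is the one required by `right-unstable`.
      factorˡ-≤ : ∀ V W → ProductIn V W A → 1 ℕ.≤ dim W → dim V ℕ.≤ D × ∃ (_∉ᶠ V)
      factorˡ-≤ V W VW⊆A 1≤w with nonzero-element W 1≤w
      ... | w , w∈W , w≉0 with unit w≉0
      ...   | w⁻¹ , w-unit@(ww⁻¹≈1 , w⁻¹w≈1) =
        dim-≤ {V} {right-preimage w-unit A} (λ v∈V → VW⊆A v∈V w∈W) ,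
        z * w⁻¹ , λ m → z∉A (A.resp
          (cancelʳ w⁻¹w≈1 z) (VW⊆A m w∈W))

      factorʳ-≤ : ∀ V W → ProductIn V W A → 1 ℕ.≤ dim V → dim W ℕ.≤ D × ∃ (_∉ᶠ W)
      factorʳ-≤ V W VW⊆A 1≤v with nonzero-element V 1≤v
      ... | v , v∈V , v≉0 with unit v≉0
      ...   | v⁻¹ , v-unit@(vv⁻¹≈1 , v⁻¹v≈1) =
        dim-≤ {W} {left-preimage v-unit A} (λ w∈W → VW⊆A v∈V w∈W) ,
        v⁻¹ * z , λ m → z∉A (A.resp
          (cancelˡ vv⁻¹≈1 z) (VW⊆A v∈V m))

      -- The two transforms of (V, W) have total dimension 2 (dim V + dim W), so one of them
      -- does not lose dimension.
      Improvement : (V W : FinSubspace) → Set _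
      Improvement V W = ∃ λ V′ → ∃ λ W′ → ProductIn V′ W′ A × 1 ℕ.≤ dim V′ × 1 ℕ.≤ dim W′ ×
        (dim V ℕ.+ dim W ℕ.< dim V′ ℕ.+ dim W′ ⊎
         dim V ℕ.+ dim W ℕ.≤ dim V′ ℕ.+ dim W′ × dim V′ ℕ.⊓ dim W′ ℕ.< dim V ℕ.⊓ dim W)

      -- The smaller factor supplies `e`. If `(V ∩ V e, W + e⁻¹ W)` keeps the total, the minimum
      -- drops because `V ∩ V e` is a proper subspace of `V`; otherwise `balance` makes the total of
      -- the other pair grow.
      improveˡ : ∀ V W → ProductIn V W A → 1 ℕ.≤ dim W → 2 ℕ.≤ dim V →
                 dim V ℕ.≤ dim W → Improvement V W
      improveˡ V W VW⊆A 1≤w 2≤v v≤w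
        with right-unstable V 2≤v (proj₂ (proj₂ (factorˡ-≤ V W VW⊆A 1≤w)))
      ... | e , (v , v∈V , v≉0 , ve∈V) , x , x∈V , xe∉V =
        choose (dim V ℕ.+ dim W ℕ.≤? dim V∩ ℕ.+ dim W⊹)
        where
        e≉0 : ¬ (e ≈ 0#)
        e≉0 e≈0 = xe∉V (FinSubspace.resp V (sym (trans (*-congˡ e≈0) (zeroʳ x))) (FinSubspace.0-closed V))
        e⁻¹ = proj₁ (unit e≉0)
        e-unit = proj₂ (unit e≉0)
        open Transform e-unit V W VW⊆A
        V∩ = V ∩ᶠ V·e
        V⊹ = V ⊹ᶠ V·e
        W∩ = W ∩ᶠ e⁻¹·W
        W⊹ = W ⊹ᶠ e⁻¹·W
        v-sum : dim V∩ ℕ.+ dim V⊹ ≡ dim V ℕ.+ dim V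
        v-sum = dim-∩-⊹ V V·e
        w-sum : dim W∩ ℕ.+ dim W⊹ ≡ dim W ℕ.+ dim W
        w-sum = dim-∩-⊹ W e⁻¹·W
        y·e : ∀ {y} → y ∈ᶠ V → y * e ∈ᶠ V·e
        y·e y∈V = FinSubspace.resp V (sym (cancelʳ (proj₁ e-unit) _)) y∈V
        ve≉0 : ¬ (v * e ≈ 0#)
        ve≉0 ve≈0 = e≉0 (no-zero-divisors ve≈0 v≉0)
        V<V⊹ : dim V ℕ.< dim V⊹
        V<V⊹ = dim-< {V} {V⊹} (⊹-inˡ (space V) (space V·e)) (⊹-inʳ (space V) (space V·e) (y·e x∈V)) xe∉V
        V∩<V : dim V∩ ℕ.< dim V
        V∩<V = below-average v-sum V<V⊹
        1≤V∩ : 1 ℕ.≤ dim V∩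
        1≤V∩ = dim-nonzero V∩ (ve∈V , y·e v∈V) ve≉0
        1≤W⊹ : 1 ℕ.≤ dim W⊹
        1≤W⊹ = ℕ.≤-trans 1≤w (dim-≤ {W} {W⊹} (⊹-inˡ (space W) (space e⁻¹·W)))
        choose : Dec (dim V ℕ.+ dim W ℕ.≤ dim V∩ ℕ.+ dim W⊹) → Improvement V W
        choose (yes grows) = V∩ , W⊹ , ∩-⊹-product , 1≤V∩ , 1≤W⊹ , inj₂ (grows ,
          ℕ.≤-<-trans (ℕ.m⊓n≤m _ _) (≡.subst (dim V∩ ℕ.<_) (≡.sym (ℕ.m≤n⇒m⊓n≡m v≤w)) V∩<V))
        choose (no shrinks) = V⊹ , W∩ , ⊹-∩-product ,
          ℕ.≤-trans (ℕ.≤-trans (s≤s z≤n) 2≤v) (ℕ.<⇒≤ V<V⊹) ,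
          balance-positive {a = dim V∩} w-sum (ℕ.≰⇒> shrinks) v≤w ,
          inj₁ (balance {a = dim V∩} {c = dim V} {d = dim W⊹} {f = dim W} v-sum
            (≡.trans (ℕ.+-comm (dim W⊹) _) w-sum) (ℕ.≰⇒> shrinks))

      improveʳ : ∀ V W → ProductIn V W A → 1 ℕ.≤ dim V → 2 ℕ.≤ dim W →
                 dim W ℕ.≤ dim V → Improvement V W
      improveʳ V W VW⊆A 1≤v 2≤w w≤v
        with left-unstable W 2≤w (proj₂ (proj₂ (factorʳ-≤ V W VW⊆A 1≤v)))
      ... | f , (w , w∈W , w≉0 , fw∈W) , x , x∈W , fx∉W =
        choose (dim V ℕ.+ dim W ℕ.≤? dim V⊹ ℕ.+ dim W∩)
        where
        f≉0 : ¬ (f ≈ 0#)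
        f≉0 f≈0 = fx∉W (FinSubspace.resp W (sym (trans (*-congʳ f≈0) (zeroˡ x))) (FinSubspace.0-closed W))
        f⁻¹ = proj₁ (unit f≉0)
        f-unit = proj₂ (unit f≉0)
        -- The transform is taken at `e = f⁻¹`, so `W` is translated to `f W`, which shares `f * w`
        -- with `W` but is not contained in it.
        open Transform (proj₂ f-unit , proj₁ f-unit) V W VW⊆A renaming (V·e to V·f⁻¹; e⁻¹·W to f·W)
        V∩ = V ∩ᶠ V·f⁻¹
        V⊹ = V ⊹ᶠ V·f⁻¹
        W∩ = W ∩ᶠ f·W
        W⊹ = W ⊹ᶠ f·W
        v-sum : dim V∩ ℕ.+ dim V⊹ ≡ dim V ℕ.+ dim V
        v-sum = dim-∩-⊹ V V·f⁻¹
        w-sum : dim W∩ ℕ.+ dim W⊹ ≡ dim W ℕ.+ dim W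
        w-sum = dim-∩-⊹ W f·W
        f·y : ∀ {y} → y ∈ᶠ W → f * y ∈ᶠ f·W
        f·y y∈W = FinSubspace.resp W (sym (cancelˡ (proj₂ f-unit) _)) y∈W
        fw≉0 : ¬ (f * w ≈ 0#)
        fw≉0 fw≈0 = w≉0 (no-zero-divisors fw≈0 f≉0)
        W<W⊹ : dim W ℕ.< dim W⊹
        W<W⊹ = dim-< {W} {W⊹} (⊹-inˡ (space W) (space f·W)) (⊹-inʳ (space W) (space f·W) (f·y x∈W)) fx∉W
        W∩<W : dim W∩ ℕ.< dim W
        W∩<W = below-average w-sum W<W⊹
        1≤W∩ : 1 ℕ.≤ dim W∩
        1≤W∩ = dim-nonzero W∩ (fw∈W , f·y w∈W) fw≉0
        1≤V⊹ : 1 ℕ.≤ dim V⊹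
        1≤V⊹ = ℕ.≤-trans 1≤v (dim-≤ {V} {V⊹} (⊹-inˡ (space V) (space V·f⁻¹)))
        choose : Dec (dim V ℕ.+ dim W ℕ.≤ dim V⊹ ℕ.+ dim W∩) → Improvement V W
        choose (yes grows) = V⊹ , W∩ , ⊹-∩-product , 1≤V⊹ , 1≤W∩ , inj₂ (grows ,
          ℕ.≤-<-trans (ℕ.m⊓n≤n (dim V⊹) _) (≡.subst (dim W∩ ℕ.<_) (≡.sym (ℕ.m≥n⇒m⊓n≡n w≤v)) W∩<W))
        choose (no shrinks) = V∩ , W⊹ , ∩-⊹-product ,
          balance-positive {a = dim W∩} v-sum
            (≡.subst₂ ℕ._<_ (ℕ.+-comm (dim V⊹) _) (ℕ.+-comm (dim V) _) (ℕ.≰⇒> shrinks)) w≤v ,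
          ℕ.≤-trans (ℕ.≤-trans (s≤s z≤n) 2≤w) (ℕ.<⇒≤ W<W⊹) ,
          inj₁ (balance {a = dim V⊹} {c = dim V} {d = dim W∩} {f = dim W}
            (≡.trans (ℕ.+-comm (dim V⊹) _) v-sum) w-sum (ℕ.≰⇒> shrinks))

      abstract
        -- Each factor has dimension at most `D`, so a total above `D + 1` forces both dimensions to
        -- be at least 2.
        improve : ∀ V W → ProductIn V W A → 1 ℕ.≤ dim V → 1 ℕ.≤ dim W →
                  suc D ℕ.< dim V ℕ.+ dim W → Improvement V W
        improve V W VW⊆A 1≤v 1≤w large =
          [ (λ v≤w → improveˡ V W VW⊆A 1≤w 2≤v v≤w) , (λ w≤v → improveʳ V W VW⊆A 1≤v 2≤w w≤v) ]′
          (ℕ.≤-total (dim V) (dim W))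
          where
          2≤v : 2 ℕ.≤ dim V
          2≤v = ℕ.+-cancelʳ-≤ D 2 (dim V)
            (ℕ.≤-trans large (ℕ.+-monoʳ-≤ (dim V) (proj₁ (factorʳ-≤ V W VW⊆A 1≤v))))
          2≤w : 2 ℕ.≤ dim W
          2≤w = ℕ.+-cancelˡ-≤ D 2 (dim W) (ℕ.≤-trans (ℕ.≤-reflexive (ℕ.+-comm D 2))
            (ℕ.≤-trans large (ℕ.+-monoˡ-≤ (dim W) (proj₁ (factorˡ-≤ V W VW⊆A 1≤w)))))

      -- A lexicographic descent: `p` limits how far the total can still grow before exceeding
      -- `D + D`, which is impossible, and `q` exceeds the smaller dimension. Growth of the total
      -- lowers `p` and resets `q`; otherwise `q` drops.
      no-large-product : ∀ p q V W → ProductIn V W A → 1 ℕ.≤ dim V → 1 ℕ.≤ dim W →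
        dim V ℕ.⊓ dim W ℕ.< q → D ℕ.+ D ℕ.< dim V ℕ.+ dim W ℕ.+ p →
        ¬ (suc D ℕ.< dim V ℕ.+ dim W)
      no-large-product zero q V W VW⊆A 1≤v 1≤w min<q bound _ =
        ℕ.<⇒≱ bound (ℕ.≤-trans (ℕ.≤-reflexive (ℕ.+-identityʳ _))
          (ℕ.+-mono-≤ (proj₁ (factorˡ-≤ V W VW⊆A 1≤w)) (proj₁ (factorʳ-≤ V W VW⊆A 1≤v))))
      no-large-product (suc p) zero _ _ _ _ _ () _ _
      no-large-product (suc p) (suc q) V W VW⊆A 1≤v 1≤w min<q bound large =
        let V′ , W′ , V′W′⊆A , 1≤v′ , 1≤w′ , gain = improve V W VW⊆A 1≤v 1≤w large in
        [ (λ grows → no-large-product p (suc (dim V′ ℕ.⊓ dim W′)) V′ W′ V′W′⊆A 1≤v′ 1≤w′ ℕ.≤-refl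
            (ℕ.<-≤-trans bound (ℕ.≤-trans (ℕ.≤-reflexive (ℕ.+-suc _ p)) (ℕ.+-monoˡ-≤ p grows)))
            (ℕ.<-trans large grows))
        , (λ (grows , min<) → no-large-product (suc p) q V′ W′ V′W′⊆A 1≤v′ 1≤w′
            (ℕ.<-≤-trans min< (ℕ.s≤s⁻¹ min<q))
            (ℕ.<-≤-trans bound (ℕ.+-monoˡ-≤ (suc p) grows)) (ℕ.<-≤-trans large grows))
        ]′ gain

      linear-cauchy-davenport : ∀ V W → ProductIn V W A → 1 ℕ.≤ dim V → 1 ℕ.≤ dim W →
                                dim V ℕ.+ dim W ℕ.≤ suc D
      linear-cauchy-davenport V W VW⊆A 1≤v 1≤w = ℕ.≮⇒≥ (no-large-product (suc (D ℕ.+ D)) (suc (dim V ℕ.⊓ dim W))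
        V W VW⊆A 1≤v 1≤w ℕ.≤-refl (ℕ.m≤n+m (suc (D ℕ.+ D)) (dim V ℕ.+ dim W)))

  -- Hall's condition and Rado's theorem for hyperplanes

  -- Including `B` makes the meet over the empty index set equal to `B`.
  meet : ∀ {n} → FinSubspace → Vector FinSubspace n → Subset.Subset n → Subspace
  meet B V J = mkSubspace (λ x → x ∈ᶠ B × (∀ i → i Subset.∈ J → x ∈ᶠ V i)) record
    { resp     = λ x≈y (b , v) → B.resp x≈y b , λ i i∈J → FinSubspace.resp (V i) x≈y (v i i∈J)
    ; 0-closed = B.0-closed , λ i _ → FinSubspace.0-closed (V i)
    ; +-closed = λ (b , v) (b′ , v′) → B.+-closed b b′ ,
        λ i i∈J → FinSubspace.+-closed (V i) (v i i∈J) (v′ i i∈J)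
    ; *-closed = λ s∈K (b , v) → B.*-closed s∈K b , λ i i∈J → FinSubspace.*-closed (V i) s∈K (v i i∈J)
    }
    where
    module B = FinSubspace B

  meetᶠ : ∀ {n} → FinSubspace → Vector FinSubspace n → Subset.Subset n → FinSubspace
  meetᶠ B V J = mkFin (proj₂ (dim-sub (meet B V J) (hasDim B) proj₁))

  -- For `dim B = n` this asks that the meet over `J` have codimension at least `∣ J ∣` in `B`. For
  -- subspaces `V i` of `B`, it is Rado's condition for an independent transversal of their
  -- annihilators.
  Hall : ∀ {n} → FinSubspace → Vector FinSubspace n → Set
  Hall {n} B V = ∀ J → dim (meetᶠ B V J) ℕ.+ Subset.∣ J ∣ ℕ.≤ n

  _∔_ : FinSubspace → Carrier → FinSubspace
  A ∔ x with dec (x ∈ᶠ A)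
  ... | yes _   = A
  ... | no x∉A = mkFin (suc (split-line (space A) x∉A) (hasDim A))

  ∔-⊆ : ∀ A x → ⟦ space (A ∔ x) ⟧ ⊆ ⟦ space A ⊹ line x ⟧
  ∔-⊆ A x with dec (x ∈ᶠ A)
  ... | yes _ = ⊹-inˡ (space A) (line x)
  ... | no _  = id

  ∔-inˡ : ∀ A x → A ⊆ᶠ A ∔ x
  ∔-inˡ A x with dec (x ∈ᶠ A)
  ... | yes _ = id
  ... | no _  = ⊹-inˡ (space A) (line x)

  ∔-lub : ∀ A B {x} → A ⊆ᶠ B → x ∈ᶠ B → A ∔ x ⊆ᶠ B
  ∔-lub A B {x} A⊆B x∈B = ⊹-lub (space A) (line x) (space B) A⊆B (line-⊆ (space B) x∈B) ∘ ∔-⊆ A x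

  dim-∔ : ∀ A {x} → x ∉ᶠ A → dim (A ∔ x) ≡ suc (dim A)
  dim-∔ A {x} x∉A with dec (x ∈ᶠ A)
  ... | yes x∈A = contradiction x∈A x∉A
  ... | no _    = ≡.refl

  ∈-≡ : ∀ {A B x} → A ≡ B → x ∈ᶠ A → x ∈ᶠ B
  ∈-≡ ≡.refl = id

  enlarge : ∀ {n} → Vector FinSubspace n → Fin n → Carrier → Vector FinSubspace n
  enlarge V i x = updateAt V i (_∔ x)

  module _ {n} (V : Vector FinSubspace n) (i : Fin n) (x : Carrier) where

    enlarge-≡ : enlarge V i x i ≡ V i ∔ x
    enlarge-≡ = updateAt-updates i V

    enlarge-minimal : ∀ {j} → ¬ j ≡ i → enlarge V i x j ≡ V j
    enlarge-minimal {j} j≢i = updateAt-minimal j i V j≢i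

    ⊆-enlarge : ∀ j → V j ⊆ᶠ enlarge V i x j
    ⊆-enlarge j with j Fin.≟ i
    ... | yes ≡.refl = ∈-≡ (≡.sym enlarge-≡) ∘ ∔-inˡ (V i) x
    ... | no j≢i     = ∈-≡ (≡.sym (enlarge-minimal j≢i))

    enlarge-⊆ : ∀ {B} → (∀ j → V j ⊆ᶠ B) → x ∈ᶠ B → ∀ j → enlarge V i x j ⊆ᶠ B
    enlarge-⊆ {B} V⊆B x∈B j with j Fin.≟ i
    ... | yes ≡.refl = ∔-lub (V i) B (V⊆B i) x∈B ∘ ∈-≡ enlarge-≡
    ... | no j≢i     = V⊆B j ∘ ∈-≡ (enlarge-minimal j≢i)

    -- If `i` is not in `J`, the enlargement leaves the meet over `J` unchanged, and `hall` bounds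
    -- it.
    violation-∋ : ∀ {B J} → Hall B V → n ℕ.< dim (meetᶠ B (enlarge V i x) J) ℕ.+ Subset.∣ J ∣ → i Subset.∈ J
    violation-∋ {B} {J} hall violated with i Subset.∈? J
    ... | yes i∈J = i∈J
    ... | no i∉J = contradiction
      (ℕ.≤-trans (ℕ.+-monoˡ-≤ Subset.∣ J ∣ (dim-≤ {meetᶠ B (enlarge V i x) J} {meetᶠ B V J} incl)) (hall J))
      (ℕ.<⇒≱ violated)
      where
      incl : ⟦ meet B (enlarge V i x) J ⟧ ⊆ ⟦ meet B V J ⟧
      incl (b , v) = b , λ j j∈J → ∈-≡ (enlarge-minimal λ { ≡.refl → i∉J j∈J }) (v j j∈J)

  -- If both J₁ and J₂ violate Hall's condition after adjoining x, respectively y, to Vᵢ,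
  -- the modular law for the two intersections contradicts the condition for J₁ ∪ J₂ or
  -- for (J₁ ∩ J₂) ∖ {i}.
  enlarge-Hall : ∀ {n B} (V : Vector FinSubspace n) i {x y} → Hall B V →
    y ∉ ⟦ space (V i) ⊹ line x ⟧ → Hall B (enlarge V i x) ⊎ Hall B (enlarge V i y)
  enlarge-Hall {n} {B} V i {x} {y} hall y∉ with dec (Hall B (enlarge V i x)) | dec (Hall B (enlarge V i y))
  ... | yes h | _ = inj₁ h
  ... | no _ | yes h = inj₂ h
  ... | no ¬h₁ | no ¬h₂ = ⊥-elim (absurd (¬∀⇒∃¬ ¬h₁) (¬∀⇒∃¬ ¬h₂))
    where
    absurd : (∃ λ J → ¬ dim (meetᶠ B (enlarge V i x) J) ℕ.+ Subset.∣ J ∣ ℕ.≤ n) →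
             (∃ λ J → ¬ dim (meetᶠ B (enlarge V i y) J) ℕ.+ Subset.∣ J ∣ ℕ.≤ n) → ⊥
    absurd (J₁ , ≰₁) (J₂ , ≰₂) = hall-counting
      {d = dim X} {dim Y} {Subset.∣ J₁ ∣} {Subset.∣ J₂ ∣} {dim (X ∩ᶠ Y)} {dim (X ⊹ᶠ Y)}
      (ℕ.≰⇒> ≰₁) (ℕ.≰⇒> ≰₂) (dim-∩-⊹ X Y) (∣p∩q∣+∣p∪q∣ J₁ J₂)
      (ℕ.≤-trans (ℕ.+-monoˡ-≤ _ (dim-≤ {X ∩ᶠ Y} {meetᶠ B V (J₁ Subset.∪ J₂)} incl-∪)) (hall (J₁ Subset.∪ J₂)))
      (ℕ.≤-trans (ℕ.+-monoˡ-≤ _ (dim-≤ {X ⊹ᶠ Y} {meetᶠ B V J₀} incl-∩)) (hall J₀))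
      (∣p∣≤1+∣p-x∣ (J₁ Subset.∩ J₂) i)
      where
      X = meetᶠ B (enlarge V i x) J₁
      Y = meetᶠ B (enlarge V i y) J₂
      J₀ = (J₁ Subset.∩ J₂) Subset.- i
      module Vᵢ = FinSubspace (V i)
      module Vᵢ⊹x = Subspace (space (V i) ⊹ line x)

      -- Because `y ∉ Vᵢ + K x`, the two enlargements of `V i` intersect in `V i` alone. Both
      -- violating sets contain `i`, so this puts `X ∩ Y` inside `V i`.
      both : ∀ {z} → z ∈ ⟦ space (V i) ⊹ line x ⟧ → z ∈ ⟦ space (V i) ⊹ line y ⟧ → z ∈ᶠ V i
      both {z} z∈₁ (b , (s , s∈K , b≈sy) , z+b∈) = Vᵢ.resp z+b≈z z+b∈
        where
        s≈0 : s ≈ 0#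
        s≈0 = Vᵢ⊹x.fresh⇒0 s∈K (Vᵢ⊹x.resp b≈sy (Vᵢ⊹x.+-cancelˡ-∈ (⊹-inˡ (space (V i)) (line x) z+b∈) z∈₁)) y∉
        z+b≈z : z + b ≈ z
        z+b≈z = trans (+-congˡ b≈sy) (x+0y≈x y s≈0)

      incl-∪ : ⟦ space X ∩ space Y ⟧ ⊆ ⟦ meet B V (J₁ Subset.∪ J₂) ⟧
      incl-∪ {z} ((b , v₁) , (_ , v₂)) = b , in-V
        where
        in-V : ∀ j → j Subset.∈ J₁ Subset.∪ J₂ → z ∈ᶠ V j
        in-V j j∈ with j Fin.≟ i
        ... | yes ≡.refl = both
          (∔-⊆ (V i) x (∈-≡ (enlarge-≡ V i x) (v₁ i (violation-∋ V i x {B} hall (ℕ.≰⇒> ≰₁)))))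
          (∔-⊆ (V i) y (∈-≡ (enlarge-≡ V i y) (v₂ i (violation-∋ V i y {B} hall (ℕ.≰⇒> ≰₂)))))
        ... | no j≢i with Subset.x∈p∪q⁻ J₁ J₂ j∈
        ...   | inj₁ j∈J₁ = ∈-≡ (enlarge-minimal V i x j≢i) (v₁ j j∈J₁)
        ...   | inj₂ j∈J₂ = ∈-≡ (enlarge-minimal V i y j≢i) (v₂ j j∈J₂)

      incl-∩ : ⟦ space X ⊹ space Y ⟧ ⊆ ⟦ meet B V J₀ ⟧
      incl-∩ = ⊹-lub (space X) (space Y) (meet B V J₀)
        (λ (b , v) → b , λ j j∈ → ∈-≡ (enlarge-minimal V i x (j≢i j∈)) (v j (proj₁ (j∈₁₂ j∈))))
        (λ (b , v) → b , λ j j∈ → ∈-≡ (enlarge-minimal V i y (j≢i j∈)) (v j (proj₂ (j∈₁₂ j∈))))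
        where
        j≢i : ∀ {j} → j Subset.∈ J₀ → ¬ j ≡ i
        j≢i j∈ ≡.refl = x∉p-x (J₁ Subset.∩ J₂) i j∈
        j∈₁₂ : ∀ {j} → j Subset.∈ J₀ → j Subset.∈ J₁ × j Subset.∈ J₂
        j∈₁₂ j∈ = Subset.x∈p∩q⁻ J₁ J₂ (Subset.p─q⊆p (J₁ Subset.∩ J₂) Subset.⁅ i ⁆ j∈)

  record Extension {n} (B : FinSubspace) (V : Vector FinSubspace n) : Set (lsuc (c ⊔ ℓ ⊔ k)) where
    field
      V′      : Vector FinSubspace n
      extends : ∀ i → V i ⊆ᶠ V′ i
      within  : ∀ i → V′ i ⊆ᶠ B
      hall    : Hall B V′

  open Extension

  extension-trans : ∀ {n B} {V : Vector FinSubspace n} (E : Extension B V) → Extension B (V′ E) → Extension B V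
  extension-trans E E′ = record
    { V′ = V′ E′ ; extends = λ i → extends E′ i ∘ extends E i ; within = within E′ ; hall = hall E′ }

  -- Codimension at least 2 leaves room for two vectors independent modulo `A`, the candidates
  -- between which `enlarge-Hall` decides.
  two-fresh : ∀ A B → 2 ℕ.+ dim A ℕ.≤ dim B →
              ∃ λ x → ∃ λ y → x ∈ᶠ B × y ∈ᶠ B × x ∉ᶠ A × y ∉ ⟦ space A ⊹ line x ⟧
  two-fresh A B 2+a≤b with ⊈⇒∃ {P = ⟦ space B ⟧} {⟦ space A ⟧}
    (λ B⊆A → ℕ.<⇒≱ (ℕ.≤-trans (ℕ.n≤1+n _) 2+a≤b) (dim-≤ {B} {A} B⊆A))
  ... | x , x∈B , x∉A with ⊈⇒∃ {P = ⟦ space B ⟧} {⟦ space A ⊹ line x ⟧}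
    (λ B⊆A+x → ℕ.<⇒≱ 2+a≤b (dim-mono (hasDim B) (suc (split-line (space A) x∉A) (hasDim A)) B⊆A+x))
  ...   | y , y∈B , y∉A+x = x , y , x∈B , y∈B , x∉A , y∉A+x

  -- codim bounds the number of enlargements still needed at i.
  saturate-at : ∀ {n B} codim i (V : Vector FinSubspace n) → (∀ j → V j ⊆ᶠ B) → Hall B V →
                dim B ℕ.≤ suc (dim (V i)) ℕ.+ codim →
                Σ[ E ∈ Extension B V ] dim B ℕ.≤ suc (dim (V′ E i))
  saturate-at zero i V V⊆B hall bound =
    record { V′ = V ; extends = λ _ → id ; within = V⊆B ; hall = hall } ,
    ℕ.≤-trans bound (ℕ.≤-reflexive (ℕ.+-identityʳ _))
  saturate-at {n} {B} (suc codim) i V V⊆B hallV bound with dim B ℕ.≤? suc (dim (V i))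
  ... | yes done = record { V′ = V ; extends = λ _ → id ; within = V⊆B ; hall = hallV } , done
  ... | no ¬done = case two-fresh (V i) B (ℕ.≰⇒> ¬done) of λ
      (x , y , x∈B , y∈B , x∉ , y∉) →
        [ adjoin x x∈B x∉ , adjoin y y∈B (y∉ ∘ ⊹-inˡ (space (V i)) (line x)) ]′ (enlarge-Hall {B = B} V i hallV y∉)
    where
    adjoin : ∀ x → x ∈ᶠ B → x ∉ᶠ V i → Hall B (enlarge V i x) →
             Σ[ E ∈ Extension B V ] dim B ℕ.≤ suc (dim (V′ E i))
    adjoin x x∈B x∉ hall′ =
      let E , bound′ = saturate-at {B = B} codim i (enlarge V i x) within′ hall′ codim-drops in
      extension-trans record
        { V′ = enlarge V i x ; extends = ⊆-enlarge V i x ; within = within′ ; hall = hall′ } E ,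
      bound′
      where
      within′ : ∀ j → enlarge V i x j ⊆ᶠ B
      within′ = enlarge-⊆ V i x {B} V⊆B x∈B
      codim-drops : dim B ℕ.≤ suc (dim (enlarge V i x i)) ℕ.+ codim
      codim-drops = ℕ.≤-trans bound (ℕ.≤-reflexive (≡.trans (ℕ.+-suc _ codim)
        (≡.cong (λ d → suc d ℕ.+ codim) (≡.sym (≡.trans (≡.cong dim (enlarge-≡ V i x)) (dim-∔ (V i) x∉))))))

  -- Later extensions only enlarge the spaces, so a codimension bound once reached persists.
  saturate : ∀ {n B} (is : List (Fin n)) (V : Vector FinSubspace n) → (∀ j → V j ⊆ᶠ B) → Hall B V →
             Σ[ E ∈ Extension B V ] All (λ i → dim B ℕ.≤ suc (dim (V′ E i))) is
  saturate [] V V⊆B hallV = record { V′ = V ; extends = λ _ → id ; within = V⊆B ; hall = hallV } , []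
  saturate {B = B} (i ∷ is) V V⊆B hallV =
    let E , bound = saturate-at {B = B} (dim B) i V V⊆B hallV (ℕ.m≤n+m (dim B) _)
        E′ , bounds = saturate {B = B} is (V′ E) (within E) (hall E)
    in extension-trans E E′ ,
       ℕ.≤-trans bound (s≤s (dim-≤ {V′ E i} {V′ E′ i} (extends E′ i))) ∷ bounds

  -- Each further space has codimension at most 1 in `B`, so by the modular law intersecting with it
  -- costs at most one dimension.
  dim-meet-hyperplanes : ∀ {n B} (V : Vector FinSubspace n) → (∀ i → V i ⊆ᶠ B) →
    (∀ i → dim B ℕ.≤ suc (dim (V i))) → ∀ J → dim B ℕ.≤ dim (meetᶠ B V J) ℕ.+ Subset.∣ J ∣
  dim-meet-hyperplanes {B = B} V V⊆B codim≤1 [] =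
    ℕ.≤-trans (dim-≤ {B} {meetᶠ B V []} λ x∈B → x∈B , λ _ ()) (ℕ.m≤m+n _ 0)
  dim-meet-hyperplanes {B = B} V V⊆B codim≤1 (Subset.outside ∷ J) =
    ℕ.≤-trans (dim-meet-hyperplanes {B = B} (tail V) (V⊆B ∘ suc) (codim≤1 ∘ suc) J)
      (ℕ.+-monoˡ-≤ Subset.∣ J ∣ (dim-≤ {meetᶠ B (tail V) J} {meetᶠ B V (Subset.outside ∷ J)}
        λ (b , v) → b , λ { (suc i) (there i∈J) → v i i∈J }))
  dim-meet-hyperplanes {B = B} V V⊆B codim≤1 (Subset.inside ∷ J) =
    ℕ.≤-trans (dim-meet-hyperplanes {B = B} (tail V) (V⊆B ∘ suc) (codim≤1 ∘ suc) J)
      (ℕ.≤-trans (ℕ.+-monoˡ-≤ Subset.∣ J ∣ w≤)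
        (ℕ.≤-trans (ℕ.≤-reflexive (≡.sym (ℕ.+-suc _ Subset.∣ J ∣)))
          (ℕ.+-monoˡ-≤ (suc Subset.∣ J ∣) (dim-≤ {V zero ∩ᶠ W} {meetᶠ B V (Subset.inside ∷ J)}
            λ (v₀ , b , v) → b , λ { zero _ → v₀ ; (suc i) (there i∈J) → v i i∈J }))))
    where
    W = meetᶠ B (tail V) J
    sum⊆B : V zero ⊹ᶠ W ⊆ᶠ B
    sum⊆B = ⊹-lub (space (V zero)) (space W) (space B) (V⊆B zero) proj₁
    w≤ : dim W ℕ.≤ suc (dim (V zero ∩ᶠ W))
    w≤ = +-exchange-≤ (dim-∩-⊹ (V zero) W) (ℕ.≤-trans (dim-≤ {V zero ⊹ᶠ W} {B} sum⊆B) (codim≤1 zero))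

  -- Omitting `V i` leaves a meet of positive dimension, from which a nonzero `b i` is chosen. By
  -- `hall` at the full index set the whole meet is zero, so `b i ∉ V i`. Reducing a linear relation
  -- modulo `V i` then isolates its `i`-th term, which gives independence.
  codim-≤1⇒basis : ∀ {n} B (V : Vector FinSubspace (suc n)) → dim B ≡ suc n →
    (∀ i → V i ⊆ᶠ B) → Hall B V → (∀ i → dim B ℕ.≤ suc (dim (V i))) →
    Σ[ b ∈ Vector Carrier (suc n) ] IsBasis L K ⟦ space B ⟧ b ×
      (∀ i j → ¬ j ≡ i → b i ∈ᶠ V j) × (∀ i → b i ∉ᶠ V i)
  codim-≤1⇒basis {n} B V ≡.refl V⊆B hall codim≤1 =
    b , independent⇒basis (hasDim B) independent (λ i → proj₁ (proj₁ (proj₂ (chosen i)))) , b∈V , b∉V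
    where
    others : Fin (suc n) → Subset.Subset (suc n)
    others i = Subset.⊤ Subset.- i
    1≤dim : ∀ i → 1 ℕ.≤ dim (meetᶠ B V (others i))
    1≤dim i = ℕ.+-cancelʳ-≤ Subset.∣ others i ∣ 1 _ (ℕ.≤-trans
      (ℕ.≤-trans (Subset.x∈p⇒∣p-x∣<∣p∣ {x = i} {p = Subset.⊤ {suc n}} Subset.∈⊤)
        (ℕ.≤-reflexive (Subset.∣⊤∣≡n (suc n))))
      (dim-meet-hyperplanes {B = B} V V⊆B codim≤1 (others i)))
    chosen : ∀ i → ∃ λ x → x ∈ᶠ meetᶠ B V (others i) × ¬ (x ≈ 0#)
    chosen i = nonzero-element (meetᶠ B V (others i)) (1≤dim i)
    b : Vector Carrier (suc n)
    b i = proj₁ (chosen i)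
    b∈V : ∀ i j → ¬ j ≡ i → b i ∈ᶠ V j
    b∈V i j j≢i = proj₂ (proj₁ (proj₂ (chosen i))) j (Subset.x∈p∧x≢y⇒x∈p-y Subset.∈⊤ j≢i)
    b∉V : ∀ i → b i ∉ᶠ V i
    b∉V i bᵢ∈Vᵢ = ℕ.<⇒≱ (ℕ.+-monoˡ-≤ Subset.∣ Subset.⊤ {suc n} ∣
        (dim-nonzero (meetᶠ B V Subset.⊤) bᵢ∈ (proj₂ (proj₂ (chosen i)))))
      (ℕ.≤-trans (hall Subset.⊤) (ℕ.≤-reflexive (≡.sym (Subset.∣⊤∣≡n (suc n)))))
      where
      bᵢ∈ : b i ∈ᶠ meetᶠ B V Subset.⊤
      bᵢ∈ = proj₁ (proj₁ (proj₂ (chosen i))) , λ j _ → case j Fin.≟ i of λ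
        { (yes ≡.refl) → bᵢ∈Vᵢ ; (no j≢i) → b∈V i j j≢i }
    independent : LinearlyIndependent L K b
    independent s s∈K sum≈0 i = Vᵢ.fresh⇒0 (s∈K i)
      (Vᵢ.+-cancelʳ-∈ (Vᵢ.resp (trans (sym sum≈0) (sum-remove {i = i} (λ j → s j * b j))) Vᵢ.0-closed)
        (sum-closed (space (V i)) (removeAt s i) (removeAt b i) (s∈K ∘ punchIn i)
          λ j → b∈V (punchIn i j) i (Fin.punchInᵢ≢i i j ∘ ≡.sym)))
      (b∉V i)
      where
      module Vᵢ = FinSubspace (V i)

  -- Matched bases in the absence of intermediate division rings

  ∈-Span-removeAt : ∀ {n} (b : Vector Carrier (suc n)) A i → (∀ j → ¬ j ≡ i → b j ∈ ⟦ A ⟧) → b i ∉ ⟦ A ⟧ →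
                    ∀ {x} → x ∈ ⟦ A ⟧ → x ∈ Span L K b → x ∈ Span L K (removeAt b i)
  ∈-Span-removeAt b A i b∈A bᵢ∉A {x} x∈A (s , s∈K , x≈) =
    removeAt s i , s∈K ∘ punchIn i , trans split (trans (+-comm _ _) (x+0y≈x (b i) sᵢ≈0))
    where
    module A = Subspace A
    rest = sum (λ j → removeAt s i j * removeAt b i j)
    split : x ≈ s i * b i + rest
    split = trans x≈ (sum-remove {i = i} (λ j → s j * b j))
    sᵢ≈0 : s i ≈ 0#
    sᵢ≈0 = A.fresh⇒0 (s∈K i) (A.+-cancelʳ-∈ (A.resp split x∈A)
      (sum-closed A (removeAt s i) (removeAt b i) (s∈K ∘ punchIn i)
        λ j → b∈A (punchIn i j) (Fin.punchInᵢ≢i i j))) bᵢ∉A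

  -- The span of the `u i` with `i ∈ J`, specified by its dimension and by minimality among
  -- subspaces containing these vectors. Minimality extends a bound on products from the generators
  -- to all of `W`.
  span-on : ∀ {n} (u : Vector Carrier n) → LinearlyIndependent L K u → (J : Subset.Subset n) →
    Σ[ W ∈ FinSubspace ] dim W ≡ Subset.∣ J ∣ ×
      (∀ (P : Subspace) → (∀ i → i Subset.∈ J → u i ∈ ⟦ P ⟧) → ⟦ space W ⟧ ⊆ ⟦ P ⟧)
  span-on u ind [] = mkFin (zero {A = zeroSubspace} λ (lift x≈0) → x≈0) , ≡.refl ,
    λ P _ (lift x≈0) → Subspace.resp P (sym x≈0) (Subspace.0-closed P)
  span-on u ind (Subset.outside ∷ J) = let W , dimW , W⊆ = span-on (tail u) (independent-tail u ind) J in
    W , dimW , λ P u∈P → W⊆ P (λ i i∈J → u∈P (suc i) (there i∈J))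
  span-on u ind (Subset.inside ∷ J) = let W , dimW , W⊆ = span-on (tail u) (independent-tail u ind) J in
    mkFin (suc (split-line (space W)
      (head∉span-tail u ind ∘ W⊆ (span (tail u)) λ i _ → ∈-span (tail u) i)) (hasDim W)) ,
    ≡.cong suc dimW ,
    λ P u∈P → ⊹-lub (space W) (line (head u)) P (W⊆ P (λ i i∈J → u∈P (suc i) (there i∈J)))
      (line-⊆ P (u∈P zero here))

  module _ (no-intermediate : NoIntermediate) {n} (A B : FinSubspace) (dimA : dim A ≡ suc n)
           (dimB : dim B ≡ suc n) (1∉B : 1# ∉ᶠ B)
           (u : Vector Carrier (suc n)) (u-basis : IsBasis L K ⟦ space A ⟧ u) where

    quotient : Vector FinSubspace (suc n)
    quotient i = mkFin (proj₂ (dim-sub (space B ∩ preimage (left-mul (u i)) (space A)) (hasDim B) proj₁))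

    quotient-Hall : Hall B quotient
    quotient-Hall J with Subset.∣ J ∣ in eq | span-on u (IsBasis.independent u-basis) J
    -- For empty `J` the factor `W` would be zero, outside the scope of the Cauchy-Davenport
    -- inequality; here `dim B` suffices as a bound.
    ... | zero  | _ = ℕ.≤-trans (ℕ.≤-reflexive (ℕ.+-identityʳ _))
      (ℕ.≤-trans (dim-≤ {meetᶠ B quotient J} {B} proj₁) (ℕ.≤-reflexive dimB))
    ... | suc m | W , dimW , W⊆ = ℕ.s≤s⁻¹ (≡.subst₂ ℕ._≤_
        (≡.trans (ℕ.+-comm (dim W) _) (≡.cong (suc d ℕ.+_) dimW)) (≡.cong suc dimA)
        (linear-cauchy-davenport no-intermediate A (proj₂ outside-A) W X product
          (≡.subst (1 ℕ.≤_) (≡.sym dimW) (s≤s z≤n)) (s≤s z≤n)))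
      where
      module A = FinSubspace A
      M = meetᶠ B quotient J
      d = dim M
      X : FinSubspace
      -- Adjoining `1#` raises the dimension of `M` by one because `1# ∉ B`; this offsets the `+ 1`
      -- in the Cauchy-Davenport bound.
      X = mkFin (suc (split-line (space M) (1∉B ∘ proj₁)) (hasDim M))
      -- If `A` were all of `L`, then `B`, having the same dimension, would equal it and contain
      -- `1#`.
      outside-A : ∃ (_∉ᶠ A)
      outside-A = ¬∀⇒∃¬ λ all∈A → 1∉B (dim-≥⇒⊆ (hasDim B) (hasDim A)
        (ℕ.≤-reflexive (≡.trans dimA (≡.sym dimB))) (λ {x} _ → all∈A x) (all∈A 1#))
      product : ProductIn W X A
      product {w = x} v∈W (b , (s , s∈K , b≈s1) , m) = W⊆ (preimage (right-mul x) (space A)) uᵢx∈A v∈W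
        where
        uᵢx∈A : ∀ i → i Subset.∈ J → u i * x ∈ᶠ A
        uᵢx∈A i i∈J = A.+-cancelʳ-∈ (A.resp (distribˡ (u i) x b) (proj₂ (proj₂ m i i∈J)))
          (A.resp (sym uᵢb≈suᵢ) (A.*-closed s∈K (IsBasis.members u-basis i)))
          where
          uᵢb≈suᵢ : u i * b ≈ s * u i
          uᵢb≈suᵢ = trans (*-congˡ (trans b≈s1 (*-identityʳ s))) (sym (K-central s∈K (u i)))

    matched-basis : Σ[ v ∈ Vector Carrier (suc n) ]
                    IsBasis L K ⟦ space B ⟧ v × BasisMatched L K ⟦ space A ⟧ ⟦ space B ⟧ u v
    matched-basis with saturate {B = B} (allFin (suc n)) quotient (λ _ → proj₁) quotient-Hall
    ... | E , bounds with codim-≤1⇒basis B (Extension.V′ E) dimB (Extension.within E) (Extension.hall E)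
                            (λ i → All.lookup bounds (∈-allFin i))
    ...   | b , b-basis , b∈ , b∉ = b , b-basis , λ i x x∈B uᵢx∈A →
      ∈-Span-removeAt b (space (Extension.V′ E i)) i (λ j j≢i → b∈ j i (j≢i ∘ ≡.sym)) (b∉ i)
        (Extension.extends E i (x∈B , uᵢx∈A)) (IsBasis.spanning b-basis x∈B)

  toFin : ∀ {A : Subset L K} {n} → HasDimension L K A n → Σ[ F ∈ FinSubspace ] ⟦ space F ⟧ ≡ A × dim F ≡ n
  toFin d = mkFin (basis⇒Dim (mkSubspace _ (HasDimension.isSubspace d)) (proj₂ (HasDimension.hasBasis d))) ,
    ≡.refl , ≡.refl

  noIntermediate⇒matching : NoIntermediate → LinearMatchingProperty L K
  noIntermediate⇒matching no-intermediate n A B dA dB 1∉B u u-basis with toFin dA | toFin dB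
  ... | A′ , ≡.refl , dimA | B′ , ≡.refl , dimB =
    matched-basis no-intermediate A′ B′ dimA dimB 1∉B u u-basis

  -- An intermediate division ring prevents matching

  -- If the hyperplane `A′` contains `x`, recursion yields a hyperplane of `A′` avoiding `x`. Adding
  -- the split vector `y` restores the dimension, and `x` stays outside because `y ∉ A′`.
  complement : ∀ {A n x} → Dim A (suc n) → x ∈ ⟦ A ⟧ → ¬ (x ≈ 0#) →
               ∃ λ C → Dim C n × ⟦ C ⟧ ⊆ ⟦ A ⟧ × x ∉ ⟦ C ⟧
  complement {x = x} (suc {A′ = A′} S d) x∈A x≉0 with dec (x ∈ ⟦ A′ ⟧)
  ... | no x∉A′ = A′ , d , Split.sub S , x∉A′
  complement (suc S (zero A′≈0)) x∈A x≉0 | yes x∈A′ = contradiction (A′≈0 x∈A′) x≉0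
  complement {A} {x = x} (suc {x = y} {A′ = A′} S d@(suc _ _)) x∈A x≉0 | yes x∈A′ with complement d x∈A′ x≉0
  ... | C , dC , C⊆A′ , x∉C = C ⊹ line y , suc (split-line C (Split.fresh S ∘ C⊆A′)) dC ,
    ⊹-lub C (line y) A (Split.sub S ∘ C⊆A′) (line-⊆ A (Split.member S)) ,
    λ (b , (s , s∈K , b≈sy) , x+b∈C) → x∉C (Subspace.resp C
      (trans (+-congˡ b≈sy) (x+0y≈x y (A′.fresh⇒0 s∈K
        (A′.resp b≈sy (A′.+-cancelˡ-∈ (C⊆A′ x+b∈C) x∈A′)) (Split.fresh S)))) x+b∈C)
    where
    module A′ = Subspace A′

  -- The coordinate hyperplanes of an independent family have zero intersection: by uniqueness of
  -- coordinates, an expansion omitting `v i` forces the `i`-th coordinate to vanish.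
  Span-removeAt⇒0 : ∀ {n} (v : Vector Carrier (suc n)) → LinearlyIndependent L K v →
    ∀ {x} → x ∈ Span L K v → (∀ i → x ∈ Span L K (removeAt v i)) → x ≈ 0#
  Span-removeAt⇒0 {n} v ind {x} (s , s∈K , x≈) x∈ =
    trans x≈ (sum-zero _ λ i → trans (*-congʳ (s≈0 i)) (zeroˡ (v i)))
    where
    sum-zero : ∀ {m} (t : Vector Carrier m) → (∀ i → t i ≈ 0#) → sum t ≈ 0#
    sum-zero {m} t t≈0 = trans (sum-cong-≋ t≈0) (sum-replicate-zero m)

    s≈0 : ∀ i → s i ≈ 0#
    s≈0 i with x∈ i
    ... | t , t∈K , x≈t = begin
      s i           ≈⟨ +-identityʳ (s i) ⟨
      s i + 0#      ≈⟨ +-congˡ -0#≈0# ⟨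
      s i + - 0#    ≡⟨ ≡.cong (λ y → s i + - y) (insertAt-lookup t i 0#) ⟨
      r i           ≈⟨ ind r r∈K r-sum≈0 i ⟩
      0#            ∎
      where
      -- Padding `t` with a zero at `i` gives a second expansion of `x` over `v`; the difference `r`
      -- of the two is a relation whose `i`-th coefficient is `s i - 0`.
      t′ = insertAt t i 0#
      r : Vector Carrier (suc n)
      r j = s j + - t′ j
      t′∈K : ∀ j → t′ j ∈ K
      t′∈K j with j Fin.≟ i
      ... | yes ≡.refl = K.resp (reflexive (≡.sym (insertAt-lookup t i 0#))) K.0-closed
      ... | no j≢i = K.resp (reflexive (≡.trans (≡.sym (insertAt-punchIn t i 0# (punchOut (j≢i ∘ ≡.sym))))
                       (≡.cong t′ (Fin.punchIn-punchOut (j≢i ∘ ≡.sym))))) (t∈K _)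
      r∈K : ∀ j → r j ∈ K
      r∈K j = K.+-closed (s∈K j) (K.neg-closed (t′∈K j))
      t′-sum : sum (λ j → t′ j * v j) ≈ x
      t′-sum = begin
        sum (λ j → t′ j * v j)
          ≈⟨ sum-remove {i = i} (λ j → t′ j * v j) ⟩
        t′ i * v i + sum (removeAt (λ j → t′ j * v j) i)
          ≈⟨ +-comm _ _ ⟩
        sum (removeAt (λ j → t′ j * v j) i) + t′ i * v i
          ≈⟨ x+0y≈x (v i) (reflexive (insertAt-lookup t i 0#)) ⟩
        sum (removeAt (λ j → t′ j * v j) i)
          ≈⟨ sum-cong-≋ (λ j → *-congʳ (reflexive (insertAt-punchIn t i 0# j))) ⟩
        sum (λ j → t j * removeAt v i j)
          ≈⟨ x≈t ⟨
        x ∎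
      r+t′ : ∀ j → r j * v j + t′ j * v j ≈ s j * v j
      r+t′ j = trans (sym (distribʳ (v j) (r j) (t′ j))) (*-congʳ (//-rightDividesˡ (t′ j) (s j)))
      r-sum≈0 : sum (λ j → r j * v j) ≈ 0#
      r-sum≈0 = +-cancelʳ x _ _ (begin
        sum (λ j → r j * v j) + x
          ≈⟨ +-congˡ t′-sum ⟨
        sum (λ j → r j * v j) + sum (λ j → t′ j * v j)
          ≈⟨ ∑-distrib-+ (λ j → r j * v j) (λ j → t′ j * v j) ⟨
        sum (λ j → r j * v j + t′ j * v j)
          ≈⟨ sum-cong-≋ r+t′ ⟩
        sum (λ j → s j * v j)
          ≈⟨ x≈ ⟨
        x
          ≈⟨ +-identityˡ x ⟨
        0# + x ∎)

  matching⇒noIntermediate : LinearMatchingProperty L K → NoIntermediate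
  matching⇒noIntermediate matching (M , M-isSub , (K⊆M , M⊈K) , (_ , U⊈M) , n , dM) with toFin dM
  ... | M′ , ≡.refl , dimM = go n M′ dM dimM M-isSub M⊈K U⊈M
    where
    go : ∀ n (M : FinSubspace) → HasDimension L K ⟦ space M ⟧ n → dim M ≡ n →
         IsSubDivisionRing L ⟦ space M ⟧ → ¬ (⟦ space M ⟧ ⊆ K) → ¬ (U ⊆ ⟦ space M ⟧) → ⊥
    go zero M dM dimM isSub _ _ = ℕ.<⇒≱ (dim-nonzero M (IsSubDivisionRing.1-closed isSub) (0≉1 ∘ sym))
      (ℕ.≤-reflexive dimM)
    go (suc n) M dM ≡.refl isSub M⊈K U⊈M with complement (hasDim M) (IsSubDivisionRing.1-closed isSub) (0≉1 ∘ sym)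
                                           | ⊈⇒∃ {P = U} {⟦ space M ⟧} U⊈M
    -- Closure of `M` under multiplication puts every `u i * α` in `M`, so matching would place `α`
    -- in all coordinate hyperplanes of `v`.
    ... | C , dC , C⊆M , 1∉C | z , _ , z∉M = α≉0 (Span-removeAt⇒0 v (IsBasis.independent v-basis)
            (IsBasis.spanning v-basis α∈B) λ i → v-matched i α α∈B
              (IsSubDivisionRing.*-closed isSub (IsBasis.members (proj₂ u-basis) i) (C⊆M α∈C)))
      where
      module M = FinSubspace M
      B : Subspace
      B = C ⊹ line z
      dB : Dim B (suc n)
      dB = suc (split-line C (z∉M ∘ C⊆M)) dC
      1∉B : 1# ∉ ⟦ B ⟧
      1∉B (b , (s , s∈K , b≈sz) , 1+b∈C) = 1∉C (Subspace.resp C (trans (+-congˡ b≈sz) (x+0y≈x z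
        (M.fresh⇒0 s∈K (M.resp b≈sz (M.+-cancelˡ-∈ (C⊆M 1+b∈C) (IsSubDivisionRing.1-closed isSub))) z∉M))) 1+b∈C)
      -- If `n` were `0`, `M` would be the line through `1#` and hence contained in `K`. Thus `C`
      -- has a nonzero element.
      1≤n : 1 ℕ.≤ n
      1≤n = ℕ.≰⇒> λ n≤0 → M⊈K λ x∈M → case dim-≥⇒⊆ (dim-line 1# (0≉1 ∘ sym)) (hasDim M) (s≤s n≤0)
        (line-⊆ (space M) (IsSubDivisionRing.1-closed isSub)) x∈M of λ
          (s , s∈K , x≈s1) → K.resp (sym (trans x≈s1 (*-identityʳ s))) s∈K
      nonzero = nonzero-element (mkFin dC) 1≤n
      α = proj₁ nonzero
      α∈C : α ∈ ⟦ C ⟧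
      α∈C = proj₁ (proj₂ nonzero)
      α≉0 : ¬ (α ≈ 0#)
      α≉0 = proj₂ (proj₂ nonzero)
      α∈B : α ∈ ⟦ B ⟧
      α∈B = ⊹-inˡ C (line z) α∈C
      u-basis = HasDimension.hasBasis dM
      matched = matching n ⟦ space M ⟧ ⟦ B ⟧ dM (Dim⇒HasDimension dB) 1∉B (proj₁ u-basis) (proj₂ u-basis)
      v = proj₁ matched
      v-basis : IsBasis L K ⟦ B ⟧ v
      v-basis = proj₁ (proj₂ matched)
      v-matched : BasisMatched L K ⟦ space M ⟧ ⟦ B ⟧ (proj₁ u-basis) v
      v-matched = proj₂ (proj₂ matched)

theorem2p6 : ∀ {c ℓ k} → (∀ {p} → ExcludedMiddle p) →
    (L : DivisionRing c ℓ) (K : Pred (DivisionRing.Carrier L) k) →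
    IsSubDivisionRing L K → IsCommutativeSubset L K → IsCentral L K →
    LinearMatchingProperty L K ⇔
    (¬ (Σ[ M ∈ Subset L K ]
    (IsSubDivisionRing L M × K ⊂ M × M ⊂ U × FiniteDimensional L K M)))
theorem2p6 em L K K-isSubDivisionRing _ K-central =
  mk⇔ matching⇒noIntermediate noIntermediate⇒matching
  where
  open MatchingTheory em L K K-isSubDivisionRing K-central
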